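{- There exist absolute constants $c_1,c_2>0$ such that for every $n\ge 1$ and every boolean function $f:\{ -1,1\}^n\to\{ -1,1\}$, $$\mathrm{Ent}(f)< c_1\, I(f)+c_2\sum_{k=1}^{n} I_k(f)\log\frac{1}{I_k(f)},$$ with the convention $I_k(f)\log\frac{1}{I_k(f)}=0$ when $I_k(f)=0$.
   Context: Let $x$ be uniformly distributed on $\{ -1,1\}^n$. For $k\in[n]$, $\mu_k:\{ -1,1\}^n\to\{ -1,1\}^n$ flips the $k$-th coordinate. The influence of coordinate $k$ is $I_k(f)=\mathbb{P}_x[f(x)\neq f(\mu_k(x))]$ and the total influence is $I(f)=\sum_{k=1}^n I_k(f)$. For $S\subseteq[n]$ let $X_S(x)=\prod_{k\in S}x_k$ and $\hat f(S)=\mathbb{E}_x[f(x)X_S(x)]$ (Fourier–Walsh coefficients). The Fourier entropy is $\mathrm{Ent}(f)=\sum_{S\subseteq[n]}\hat f(S)^2\log_2\frac{1}{\hat f(S)^2}$ (terms with $\hat f(S)=0$ are $0$).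
   Formalization: The strict inequality is false for the two constant functions (both sides are 0); the formal theorem proves, with the same constants, "≤" for every boolean function and the strict "<" for every non-constant one. -}

module Defs where

open import Data.Bool.Base using (true; false)
open import Data.Fin.Base using (Fin)
open import Data.Fin.Subset using (Subset)
open import Data.Fin.Subset.Properties using (_∈?_)
open import Data.Integer.Base as ℤ using (+_; +[1+_])
import Data.Integer.Properties as ℤₚ
open import Data.List.Base using (List; []; _∷_; map; foldr; filter; length; allFin; cartesianProductWith)
open import Data.Nat.Base as ℕ using (ℕ; zero; suc; ⌊_/2⌋)
open import Data.Nat.Induction using (<-rec)
open import Data.Nat.Logarithm using (⌊log₂_⌋; ⌊log₂⌋-mono-≤; ⌊log₂⌊n/2⌋⌋≡⌊log₂n⌋∸1; ⌊log₂[2^n]⌋≡n)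
import Data.Nat.Properties as ℕₚ
open import Data.Product.Base using (Σ; ∃; ∃₂; _×_; _,_)
open import Data.Rational.Base as ℚ using (ℚ; mkℚ; 0ℚ; 1ℚ; ½)
import Data.Rational.Properties as ℚₚ
open import Data.Rational.Solver using (module +-*-Solver)
import Data.Rational.Unnormalised.Base as ℚᵘ
import Data.Rational.Unnormalised.Properties as ℚᵘₚ
open import Data.Sign.Base as Sign using (Sign)
import Data.Sign.Properties as Signₚ
open import Data.Sum.Base using (inj₁; inj₂)
open import Data.Vec.Base as Vec using (Vec; lookup; updateAt)
open import Relation.Binary.PropositionalEquality using (_≡_; _≢_; refl; sym; trans; cong; subst; subst₂)
open import Relation.Nullary using (yes; no; ¬?)
open import Relation.Unary using (Pred; Decidable)

private
  halves : ∀ ε → ½ ℚ.* ε ℚ.+ ½ ℚ.* ε ≡ ε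
  halves ε = trans (sym (ℚₚ.*-distribʳ-+ ε ½ ½)) (ℚₚ.*-identityˡ ε)

  0<½ : 0ℚ ℚ.< ½
  0<½ = ℚₚ.positive⁻¹ ½

  *-pos : ∀ {p q} → 0ℚ ℚ.< p → 0ℚ ℚ.< q → 0ℚ ℚ.< p ℚ.* q
  *-pos {p} {q} 0<p 0<q =
    ℚₚ.positive⁻¹ (p ℚ.* q) {{ℚₚ.pos*pos⇒pos p {{ℚ.positive 0<p}} q {{ℚ.positive 0<q}}}}

------------------------------------------------------------------------
-- Real numbers: Cauchy sequences of rationals.  Two sequences denote the
-- same real iff each is ≤ the other; no quotient is formed.

IsCauchy : (ℕ → ℚ) → Set
IsCauchy s = ∀ ε → 0ℚ ℚ.< ε →
  ∃ λ N → ∀ m n → N ℕ.≤ m → N ℕ.≤ n → ℚ.∣ s m ℚ.- s n ∣ ℚ.< ε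

record ℝ : Set where
  constructor mkℝ
  field
    seq    : ℕ → ℚ
    cauchy : IsCauchy seq

open ℝ public

infix 4 _<_ _≤_

_<_ : ℝ → ℝ → Set
x < y = ∃ λ ε → 0ℚ ℚ.< ε × ∃ λ N → ∀ n → N ℕ.≤ n → seq x n ℚ.+ ε ℚ.≤ seq y n

_≤_ : ℝ → ℝ → Set
x ≤ y = ∀ ε → 0ℚ ℚ.< ε → ∃ λ N → ∀ n → N ℕ.≤ n → seq x n ℚ.≤ seq y n ℚ.+ ε

fromℚ : ℚ → ℝ
fromℚ q = mkℝ (λ _ → q) λ ε 0<ε →
  0 , λ _ _ _ _ → subst (ℚ._< ε) (sym (cong ℚ.∣_∣ (ℚₚ.+-inverseʳ q))) 0<ε

0ℝ : ℝ
0ℝ = fromℚ 0ℚ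

infixl 6 _+_ _-_
infixl 7 _*_
infix  8 -_

_+_ : ℝ → ℝ → ℝ
x + y = mkℝ (λ n → seq x n ℚ.+ seq y n) λ ε 0<ε →
  let Nx , hx = cauchy x (½ ℚ.* ε) (*-pos 0<½ 0<ε)
      Ny , hy = cauchy y (½ ℚ.* ε) (*-pos 0<½ 0<ε)
  in Nx ℕ.⊔ Ny , λ m n N≤m N≤n →
    let a = seq x m ; b = seq x n ; c = seq y m ; d = seq y n
        open ℚₚ.≤-Reasoning
    in begin-strict
      ℚ.∣ (a ℚ.+ c) ℚ.- (b ℚ.+ d) ∣        ≡⟨ cong ℚ.∣_∣ (rearrange a b c d) ⟩
      ℚ.∣ (a ℚ.- b) ℚ.+ (c ℚ.- d) ∣        ≤⟨ ℚₚ.∣p+q∣≤∣p∣+∣q∣ (a ℚ.- b) (c ℚ.- d) ⟩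
      ℚ.∣ a ℚ.- b ∣ ℚ.+ ℚ.∣ c ℚ.- d ∣      <⟨ ℚₚ.+-mono-<
                                                (hx m n (ℕₚ.m⊔n≤o⇒m≤o Nx Ny N≤m) (ℕₚ.m⊔n≤o⇒m≤o Nx Ny N≤n))
                                                (hy m n (ℕₚ.m⊔n≤o⇒n≤o Nx Ny N≤m) (ℕₚ.m⊔n≤o⇒n≤o Nx Ny N≤n)) ⟩
      ½ ℚ.* ε ℚ.+ ½ ℚ.* ε                  ≡⟨ halves ε ⟩
      ε                                    ∎
  where
  rearrange : ∀ a b c d → (a ℚ.+ c) ℚ.- (b ℚ.+ d) ≡ (a ℚ.- b) ℚ.+ (c ℚ.- d)
  rearrange = solve 4 (λ a b c d → (a :+ c) :- (b :+ d) := (a :- b) :+ (c :- d)) refl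
    where open +-*-Solver

-_ : ℝ → ℝ
- x = mkℝ (λ n → ℚ.- seq x n) λ ε 0<ε →
  let N , h = cauchy x ε 0<ε
  in N , λ m n N≤m N≤n →
    subst (ℚ._< ε) (sym (cong ℚ.∣_∣ (rearrange (seq x m) (seq x n)))) (h n m N≤n N≤m)
  where
  rearrange : ∀ a b → (ℚ.- a) ℚ.- (ℚ.- b) ≡ b ℚ.- a
  rearrange = solve 2 (λ a b → (:- a) :- (:- b) := b :- a) refl
    where open +-*-Solver

_-_ : ℝ → ℝ → ℝ
x - y = x + (- y)

private
  bounded : ∀ x → ∃₂ λ N B → ℚ.Positive B × (∀ n → N ℕ.≤ n → ℚ.∣ seq x n ∣ ℚ.≤ B)
  bounded x =
    let N , h = cauchy x 1ℚ (ℚₚ.positive⁻¹ 1ℚ)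
        c = seq x N
    in N , 1ℚ ℚ.+ ℚ.∣ c ∣ , ℚₚ.pos+nonNeg⇒pos 1ℚ ℚ.∣ c ∣ {{ℚₚ.∣-∣-nonNeg c}} , λ n N≤n →
      let a = seq x n
          open ℚₚ.≤-Reasoning
      in begin
        ℚ.∣ a ∣                        ≡⟨ cong ℚ.∣_∣ (split a c) ⟩
        ℚ.∣ (a ℚ.- c) ℚ.+ c ∣          ≤⟨ ℚₚ.∣p+q∣≤∣p∣+∣q∣ (a ℚ.- c) c ⟩
        ℚ.∣ a ℚ.- c ∣ ℚ.+ ℚ.∣ c ∣      ≤⟨ ℚₚ.+-monoˡ-≤ ℚ.∣ c ∣ (ℚₚ.<⇒≤ (h n N N≤n ℕₚ.≤-refl)) ⟩
        1ℚ ℚ.+ ℚ.∣ c ∣                 ∎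
    where
    split : ∀ a c → a ≡ (a ℚ.- c) ℚ.+ c
    split = solve 2 (λ a c → a := (a :- c) :+ c) refl
      where open +-*-Solver

  scaled : ∀ B → ℚ.Positive B → ∀ ε → 0ℚ ℚ.< ε → Σ ℚ λ δ → 0ℚ ℚ.< δ × (B ℚ.* δ ≡ ε)
  scaled B B>0 ε 0<ε = 1/B ℚ.* ε , *-pos 0<1/B 0<ε ,
    trans (sym (ℚₚ.*-assoc B 1/B ε)) (trans (cong (ℚ._* ε) (ℚₚ.*-inverseʳ B)) (ℚₚ.*-identityˡ ε))
    where
    instance
      B≢0 : ℚ.NonZero B
      B≢0 = ℚₚ.pos⇒nonZero B {{B>0}}
    1/B = ℚ.1/ B
    0<1/B : 0ℚ ℚ.< 1/B
    0<1/B = ℚₚ.positive⁻¹ 1/B {{ℚₚ.1/pos⇒pos B {{B>0}}}}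

  product-bound : ∀ p q {B δ ε} → ℚ.Positive B → ℚ.∣ p ∣ ℚ.≤ B → ℚ.∣ q ∣ ℚ.< δ →
                  B ℚ.* δ ≡ ε → ℚ.∣ p ℚ.* q ∣ ℚ.< ε
  product-bound p q {B} {δ} {ε} B>0 p≤B q<δ Bδ≡ε = begin-strict
    ℚ.∣ p ℚ.* q ∣          ≡⟨ ℚₚ.∣p*q∣≡∣p∣*∣q∣ p q ⟩
    ℚ.∣ p ∣ ℚ.* ℚ.∣ q ∣    ≤⟨ ℚₚ.*-monoʳ-≤-nonNeg ℚ.∣ q ∣ {{ℚₚ.∣-∣-nonNeg q}} p≤B ⟩
    B ℚ.* ℚ.∣ q ∣          <⟨ ℚₚ.*-monoʳ-<-pos B {{B>0}} q<δ ⟩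
    B ℚ.* δ                ≡⟨ Bδ≡ε ⟩
    ε                      ∎
    where open ℚₚ.≤-Reasoning

_*_ : ℝ → ℝ → ℝ
x * y = mkℝ (λ n → seq x n ℚ.* seq y n) λ ε 0<ε →
  let Mx , A , A>0 , x≤A = bounded x
      My , B , B>0 , y≤B = bounded y
      δ , 0<δ , Bδ≡ = scaled B B>0 (½ ℚ.* ε) (*-pos 0<½ 0<ε)
      η , 0<η , Aη≡ = scaled A A>0 (½ ℚ.* ε) (*-pos 0<½ 0<ε)
      Nx , hx = cauchy x δ 0<δ
      Ny , hy = cauchy y η 0<η
      M = Mx ℕ.⊔ My
      N = Nx ℕ.⊔ Ny
  in M ℕ.⊔ N , λ m n ≤m ≤n →
    let a = seq x m ; b = seq x n ; c = seq y m ; d = seq y n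
        M≤m = ℕₚ.m⊔n≤o⇒m≤o M N ≤m
        M≤n = ℕₚ.m⊔n≤o⇒m≤o M N ≤n
        N≤m = ℕₚ.m⊔n≤o⇒n≤o M N ≤m
        N≤n = ℕₚ.m⊔n≤o⇒n≤o M N ≤n
        open ℚₚ.≤-Reasoning
    in begin-strict
      ℚ.∣ a ℚ.* c ℚ.- b ℚ.* d ∣                            ≡⟨ cong ℚ.∣_∣ (rearrange a b c d) ⟩
      ℚ.∣ a ℚ.* (c ℚ.- d) ℚ.+ d ℚ.* (a ℚ.- b) ∣            ≤⟨ ℚₚ.∣p+q∣≤∣p∣+∣q∣ (a ℚ.* (c ℚ.- d)) (d ℚ.* (a ℚ.- b)) ⟩
      ℚ.∣ a ℚ.* (c ℚ.- d) ∣ ℚ.+ ℚ.∣ d ℚ.* (a ℚ.- b) ∣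
        <⟨ ℚₚ.+-mono-<
             (product-bound a (c ℚ.- d) A>0 (x≤A m (ℕₚ.m⊔n≤o⇒m≤o Mx My M≤m))
               (hy m n (ℕₚ.m⊔n≤o⇒n≤o Nx Ny N≤m) (ℕₚ.m⊔n≤o⇒n≤o Nx Ny N≤n)) Aη≡)
             (product-bound d (a ℚ.- b) B>0 (y≤B n (ℕₚ.m⊔n≤o⇒n≤o Mx My M≤n))
               (hx m n (ℕₚ.m⊔n≤o⇒m≤o Nx Ny N≤m) (ℕₚ.m⊔n≤o⇒m≤o Nx Ny N≤n)) Bδ≡) ⟩
      ½ ℚ.* ε ℚ.+ ½ ℚ.* ε                                  ≡⟨ halves ε ⟩
      ε                                                    ∎
  where
  rearrange : ∀ a b c d → a ℚ.* c ℚ.- b ℚ.* d ≡ a ℚ.* (c ℚ.- d) ℚ.+ d ℚ.* (a ℚ.- b)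
  rearrange = solve 4 (λ a b c d → a :* c :- b :* d := a :* (c :- d) :+ d :* (a :- b)) refl
    where open +-*-Solver

∑ : ∀ {a} {A : Set a} → List A → (A → ℝ) → ℝ
∑ xs g = foldr _+_ 0ℝ (map g xs)

------------------------------------------------------------------------
-- Binary logarithm

2^⌊log₂n⌋≤n : ∀ n → .{{ℕ.NonZero n}} → 2 ℕ.^ ⌊log₂ n ⌋ ℕ.≤ n
2^⌊log₂n⌋≤n n = <-rec (λ n → .{{ℕ.NonZero n}} → 2 ℕ.^ ⌊log₂ n ⌋ ℕ.≤ n) step n
  where
  step : ∀ n → (∀ {m} → m ℕ.< n → .{{ℕ.NonZero m}} → 2 ℕ.^ ⌊log₂ m ⌋ ℕ.≤ m) →
         .{{ℕ.NonZero n}} → 2 ℕ.^ ⌊log₂ n ⌋ ℕ.≤ n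
  step 1 _ = ℕₚ.≤-refl
  step n@(suc (suc k)) ih = begin
    2 ℕ.^ ⌊log₂ n ⌋                  ≡⟨ cong (2 ℕ.^_) (sym (ℕₚ.m+[n∸m]≡n {1} 1≤log)) ⟩
    2 ℕ.^ suc (⌊log₂ n ⌋ ℕ.∸ 1)      ≡⟨ cong (λ e → 2 ℕ.* 2 ℕ.^ e) (sym (⌊log₂⌊n/2⌋⌋≡⌊log₂n⌋∸1 n)) ⟩
    2 ℕ.* 2 ℕ.^ ⌊log₂ ⌊ n /2⌋ ⌋      ≤⟨ ℕₚ.*-monoʳ-≤ 2 (ih (ℕₚ.⌊n/2⌋<n (suc k))) ⟩
    2 ℕ.* ⌊ n /2⌋                    ≡⟨ cong (⌊ n /2⌋ ℕ.+_) (ℕₚ.+-identityʳ ⌊ n /2⌋) ⟩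
    ⌊ n /2⌋ ℕ.+ ⌊ n /2⌋              ≤⟨ ℕₚ.+-monoʳ-≤ ⌊ n /2⌋ (ℕₚ.⌊n/2⌋≤⌈n/2⌉ n) ⟩
    ⌊ n /2⌋ ℕ.+ ℕ.⌈ n /2⌉            ≡⟨ ℕₚ.⌊n/2⌋+⌈n/2⌉≡n n ⟩
    n                                ∎
    where
    open ℕₚ.≤-Reasoning
    1≤log : 1 ℕ.≤ ⌊log₂ n ⌋
    1≤log = subst (ℕ._≤ ⌊log₂ n ⌋) (⌊log₂[2^n]⌋≡n 1) (⌊log₂⌋-mono-≤ {2} {n} (ℕ.s≤s (ℕ.s≤s ℕ.z≤n)))

n<2^[1+⌊log₂n⌋] : ∀ n → n ℕ.< 2 ℕ.^ suc ⌊log₂ n ⌋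
n<2^[1+⌊log₂n⌋] n = ℕₚ.≰⇒> λ 2^≤n → ℕₚ.1+n≰n
  (subst (ℕ._≤ ⌊log₂ n ⌋) (⌊log₂[2^n]⌋≡n (suc ⌊log₂ n ⌋)) (⌊log₂⌋-mono-≤ 2^≤n))

log₂ℕ-approx : ℕ → ℕ → ℚ
log₂ℕ-approx a m = + ⌊log₂ (a ℕ.^ suc m) ⌋ ℚ./ suc m

private
  module _ (a : ℕ) .{{_ : ℕ.NonZero a}} where

    L : ℕ → ℕ
    L m = ⌊log₂ (a ℕ.^ suc m) ⌋

    cross : ∀ m n → L m ℕ.* suc n ℕ.≤ suc (L n) ℕ.* suc m
    cross m n = ℕₚ.≮⇒≥ λ lt → ℕₚ.<-irrefl refl (ℕₚ.<-≤-trans (ℕₚ.^-monoʳ-< 2 (ℕ.s≤s (ℕ.s≤s ℕ.z≤n)) lt) 2^≤)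
      where
      open ℕₚ.≤-Reasoning
      2^≤ : 2 ℕ.^ (L m ℕ.* suc n) ℕ.≤ 2 ℕ.^ (suc (L n) ℕ.* suc m)
      2^≤ = begin
        2 ℕ.^ (L m ℕ.* suc n)          ≡⟨ sym (ℕₚ.^-*-assoc 2 (L m) (suc n)) ⟩
        (2 ℕ.^ L m) ℕ.^ suc n          ≤⟨ ℕₚ.^-monoˡ-≤ (suc n) (2^⌊log₂n⌋≤n (a ℕ.^ suc m) {{ℕₚ.m^n≢0 a (suc m)}}) ⟩
        (a ℕ.^ suc m) ℕ.^ suc n        ≡⟨ ℕₚ.^-*-assoc a (suc m) (suc n) ⟩
        a ℕ.^ (suc m ℕ.* suc n)        ≡⟨ cong (a ℕ.^_) (ℕₚ.*-comm (suc m) (suc n)) ⟩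
        a ℕ.^ (suc n ℕ.* suc m)        ≡⟨ sym (ℕₚ.^-*-assoc a (suc n) (suc m)) ⟩
        (a ℕ.^ suc n) ℕ.^ suc m        ≤⟨ ℕₚ.^-monoˡ-≤ (suc m) (ℕₚ.<⇒≤ (n<2^[1+⌊log₂n⌋] (a ℕ.^ suc n))) ⟩
        (2 ℕ.^ suc (L n)) ℕ.^ suc m    ≡⟨ ℕₚ.^-*-assoc 2 (suc (L n)) (suc m) ⟩
        2 ℕ.^ (suc (L n) ℕ.* suc m)    ∎

    frac-≤ : ∀ p q m n → p ℕ.* suc n ℕ.≤ q ℕ.* suc m → + p ℚ./ suc m ℚ.≤ + q ℚ./ suc n
    frac-≤ p q m n h = ℚₚ.toℚᵘ-cancel-≤ (begin
      ℚ.toℚᵘ (+ p ℚ./ suc m)   ≃⟨ ℚₚ.toℚᵘ-fromℚᵘ (ℚᵘ.mkℚᵘ (+ p) m) ⟩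
      ℚᵘ.mkℚᵘ (+ p) m          ≤⟨ ℚᵘ.*≤* (subst₂ ℤ._≤_ (ℤₚ.pos-* p (suc n)) (ℤₚ.pos-* q (suc m)) (ℤ.+≤+ h)) ⟩
      ℚᵘ.mkℚᵘ (+ q) n          ≃⟨ ℚₚ.toℚᵘ-fromℚᵘ (ℚᵘ.mkℚᵘ (+ q) n) ⟨
      ℚ.toℚᵘ (+ q ℚ./ suc n)   ∎)
      where open ℚᵘₚ.≤-Reasoning

    frac-suc : ∀ p n → + suc p ℚ./ suc n ≡ + p ℚ./ suc n ℚ.+ + 1 ℚ./ suc n
    frac-suc p n = ℚₚ.toℚᵘ-injective (begin
      ℚ.toℚᵘ (+ suc p ℚ./ suc n)                               ≈⟨ ℚₚ.toℚᵘ-fromℚᵘ (ℚᵘ.mkℚᵘ (+ suc p) n) ⟩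
      ℚᵘ.mkℚᵘ (+ suc p) n                                      ≈⟨ ℚᵘ.*≡* eq ⟩
      ℚᵘ.mkℚᵘ (+ p) n ℚᵘ.+ ℚᵘ.mkℚᵘ (+ 1) n                     ≈⟨ ℚᵘₚ.+-cong (ℚₚ.toℚᵘ-fromℚᵘ (ℚᵘ.mkℚᵘ (+ p) n)) (ℚₚ.toℚᵘ-fromℚᵘ (ℚᵘ.mkℚᵘ (+ 1) n)) ⟨
      ℚ.toℚᵘ (+ p ℚ./ suc n) ℚᵘ.+ ℚ.toℚᵘ (+ 1 ℚ./ suc n)       ≈⟨ ℚₚ.toℚᵘ-homo-+ (+ p ℚ./ suc n) (+ 1 ℚ./ suc n) ⟨
      ℚ.toℚᵘ (+ p ℚ./ suc n ℚ.+ + 1 ℚ./ suc n)                 ∎)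
      where
      open import Relation.Binary.Reasoning.Setoid ℚᵘₚ.≃-setoid
      N = + suc n
      eq : + suc p ℤ.* + (suc n ℕ.* suc n) ≡ (+ p ℤ.* N ℤ.+ + 1 ℤ.* N) ℤ.* N
      eq = trans (cong (+ suc p ℤ.*_) (ℤₚ.pos-* (suc n) (suc n)))
          (trans (sym (ℤₚ.*-assoc (+ suc p) N N))
                 (cong (ℤ._* N) (trans (cong (ℤ._* N) (ℤₚ.+-comm (+ 1) (+ p))) (ℤₚ.*-distribʳ-+ N (+ p) (+ 1)))))

    s : ℕ → ℚ
    s = log₂ℕ-approx a

    one-sided : ∀ N m n → N ℕ.≤ n → s m ℚ.- s n ℚ.≤ + 1 ℚ./ suc N
    one-sided N m n N≤n = begin
      s m ℚ.- s n                           ≤⟨ ℚₚ.+-monoˡ-≤ (ℚ.- s n) (frac-≤ (L m) (suc (L n)) m n (cross m n)) ⟩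
      + suc (L n) ℚ./ suc n ℚ.- s n         ≡⟨ cong (ℚ._- s n) (frac-suc (L n) n) ⟩
      (s n ℚ.+ + 1 ℚ./ suc n) ℚ.- s n       ≡⟨ cancel (s n) (+ 1 ℚ./ suc n) ⟩
      + 1 ℚ./ suc n                         ≤⟨ frac-≤ 1 1 n N (ℕₚ.*-monoʳ-≤ 1 (ℕ.s≤s N≤n)) ⟩
      + 1 ℚ./ suc N                         ∎
      where
      open ℚₚ.≤-Reasoning
      cancel : ∀ p q → (p ℚ.+ q) ℚ.- p ≡ q
      cancel = solve 2 (λ p q → (p :+ q) :- p := q) refl
        where open +-*-Solver

    two-sided : ∀ N m n → N ℕ.≤ m → N ℕ.≤ n → ℚ.∣ s m ℚ.- s n ∣ ℚ.≤ + 1 ℚ./ suc N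
    two-sided N m n N≤m N≤n with ℚₚ.∣p∣≡p∨∣p∣≡-p (s m ℚ.- s n)
    ... | inj₁ eq = subst (ℚ._≤ + 1 ℚ./ suc N) (sym eq) (one-sided N m n N≤n)
    ... | inj₂ eq = subst (ℚ._≤ + 1 ℚ./ suc N) (sym (trans eq (flip (s m) (s n)))) (one-sided N n m N≤m)
      where
      flip : ∀ p q → ℚ.- (p ℚ.- q) ≡ q ℚ.- p
      flip = solve 2 (λ p q → :- (p :- q) := q :- p) refl
        where open +-*-Solver

    archimedean : ∀ ε → 0ℚ ℚ.< ε → ∃ λ N → + 1 ℚ./ suc N ℚ.< ε
    archimedean ε 0<ε with ε | ℚ.positive 0<ε
    ... | mkℚ +[1+ k ] d _ | _ = suc d , ℚₚ.toℚᵘ-cancel-< (begin-strict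
      ℚ.toℚᵘ (+ 1 ℚ./ suc (suc d))  ≃⟨ ℚₚ.toℚᵘ-fromℚᵘ (ℚᵘ.mkℚᵘ (+ 1) (suc d)) ⟩
      ℚᵘ.mkℚᵘ (+ 1) (suc d)         <⟨ ℚᵘ.*<* (ℤ.+<+ (ℕₚ.<-≤-trans lt (ℕₚ.m≤m+n _ _))) ⟩
      ℚᵘ.mkℚᵘ (+[1+ k ]) d          ∎)
      where
      open ℚᵘₚ.≤-Reasoning
      lt : 1 ℕ.* suc d ℕ.< suc (suc d)
      lt = subst (ℕ._< suc (suc d)) (sym (ℕₚ.*-identityˡ (suc d))) ℕₚ.≤-refl

    log₂ℕ-cauchy : IsCauchy s
    log₂ℕ-cauchy ε 0<ε =
      let N , 1/N<ε = archimedean ε 0<ε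
      in N , λ m n N≤m N≤n → ℚₚ.≤-<-trans (two-sided N m n N≤m N≤n) 1/N<ε

-- log₂ a = lim ⌊log₂ a^(m+1)⌋ / (m+1), with error less than 1/(m+1).
log₂ℕ : (a : ℕ) → .{{ℕ.NonZero a}} → ℝ
log₂ℕ a = mkℝ (log₂ℕ-approx a) (log₂ℕ-cauchy a)

log₂ : (q : ℚ) → .{{ℚ.Positive q}} → ℝ
log₂ (mkℚ +[1+ p ] d-1 _) = log₂ℕ (suc p) - log₂ℕ (suc d-1)

-- p · log₂ (1/p).  Only used for p ≥ 0, where the second case is p = 0.
plog1/p : ℚ → ℝ
plog1/p p with 0ℚ ℚₚ.<? p
... | yes 0<p = fromℚ p * log₂ ((ℚ.1/ p) {{ℚ.>-nonZero 0<p}}) {{ℚₚ.1/pos⇒pos p {{ℚ.positive 0<p}}}}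
... | no  _   = 0ℝ

------------------------------------------------------------------------
-- The discrete cube {-1,1}ⁿ with the uniform measure

allVec : ∀ {a} {A : Set a} → List A → ∀ n → List (Vec A n)
allVec xs zero    = Vec.[] ∷ []
allVec xs (suc n) = cartesianProductWith Vec._∷_ xs (allVec xs n)

Cube : ℕ → Set
Cube n = Vec Sign n

cube : ∀ n → List (Cube n)
cube = allVec (Sign.- ∷ Sign.+ ∷ [])

subsets : ∀ n → List (Subset n)
subsets = allVec (false ∷ true ∷ [])

⟦_⟧ : Sign → ℚ
⟦ Sign.- ⟧ = ℚ.- 1ℚ
⟦ Sign.+ ⟧ = 1ℚ

𝔼 : ∀ {n} → (Cube n → ℚ) → ℚ
𝔼 {n} g = foldr ℚ._+_ 0ℚ (map g (cube n)) ℚ.* (+ 1 ℚ./ (2 ℕ.^ n)) {{ℕₚ.m^n≢0 2 n}}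

ℙ : ∀ {n p} {P : Pred (Cube n) p} → Decidable P → ℚ
ℙ {n} P? = (+ length (filter P? (cube n)) ℚ./ (2 ℕ.^ n)) {{ℕₚ.m^n≢0 2 n}}

BooleanFunction : ℕ → Set
BooleanFunction n = Cube n → Sign

NonConstant : ∀ {n} → BooleanFunction n → Set
NonConstant f = ∃₂ λ x y → f x ≢ f y

μ : ∀ {n} → Fin n → Cube n → Cube n
μ k x = updateAt x k Sign.opposite

Inf : ∀ {n} → Fin n → BooleanFunction n → ℚ
Inf k f = ℙ (λ x → ¬? (f x Signₚ.≟ f (μ k x)))

totalInf : ∀ {n} → BooleanFunction n → ℚ
totalInf {n} f = foldr ℚ._+_ 0ℚ (map (λ k → Inf k f) (allFin n))

X : ∀ {n} → Subset n → Cube n → ℚ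
X {n} S x = foldr ℚ._*_ 1ℚ (map (λ k → ⟦ lookup x k ⟧) (filter (_∈? S) (allFin n)))

fourier : ∀ {n} → BooleanFunction n → Subset n → ℚ
fourier f S = 𝔼 (λ x → ⟦ f x ⟧ ℚ.* X S x)

Ent : ∀ {n} → BooleanFunction n → ℝ
Ent {n} f = ∑ (subsets n) λ S → plog1/p (fourier f S ℚ.* fourier f S)

{-# OPTIONS --safe #-}

-- By Parseval, P(S) = f̂(S)² is a probability distribution on subsets of [n], and its marginals are
-- ℙ[k ∈ S] = I_k.  Compare P with the product distribution Q(S) = ∏_{k∈S} I_k / ∏_k (1 + I_k): Gibbs' inequality gives
-- Ent f ≤ ∑_S P(S) log (1/Q(S)) = ∑_k I_k log (1/I_k) + ∑_k log (1 + I_k), and log₂ (1 + I_k) ≤ 2 I_k.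
-- Hence c₁ = 3, c₂ = 1 work, with I(f) to spare for the strict inequality.
--
-- Both inequalities come from the tangent line log₂ t ≤ (t - 1) σ, whose exact slope 1 / ln 2 is replaced by the
-- chord slope σ = K log₂ (1 + 1/K): the bound then holds for all t in (1/K)ℕ, and K can be chosen to be a common
-- denominator of the finitely many t that occur.  At t = 1/2 it says σ ≤ 2.

module Submission where

open import Data.Nat.Base as ℕ using (ℕ)
open import Data.List.Base using (allFin)
open import Data.Product.Base using (∃₂; _×_; _,_)

-- At a finite index the approximate logarithms are additive only up to rounding, so the argument
-- runs on the rational sequences themselves, with an error `C * e m` for a constant `C`, and is
-- turned into a statement about reals only at the end. If Q were the product of the true marginals,
-- coordinates outside S would contribute factors 1 - I_k, which vanish at I_k = 1 and bring in
-- terms (1 - I_k) log (1/(1 - I_k)). Including k with odds I_k : 1 replaces them by the positive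
-- normalisers 1/(1 + I_k). Q still charges every S with P(S) > 0, because I_k ≥ P(S) for each k in
-- S. The slope σ depends on f through K. This is harmless: in Gibbs' inequality it is multiplied by
-- ∑ Q - ∑ P = 0, and in the normalisers it is bounded by 2. Strictness is claimed for non-constant
-- f, since for constant f both sides of the bound are 0.

module SpectralEntropy where

  open import Data.Bool.Base using (Bool; true; false)
  open import Data.Empty using (⊥-elim)
  open import Data.Fin.Base using (Fin; zero; suc)
  open import Data.Fin.Subset using (Subset)
  open import Data.Fin.Subset.Properties using (_∈?_)
  open import Data.Integer.Base as ℤ using (+_; +[1+_]; -[1+_])
  import Data.Integer.Properties as ℤₚ
  open import Data.List.Base using (List; []; _∷_; _++_; foldr; map; filter; length; tabulate)
  open import Data.List.Membership.Propositional using (_∈_; lose)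
  open import Data.List.Membership.Propositional.Properties using (∈-cartesianProductWith⁺; ∈-allFin; ∈-map⁺; ∈-++⁺ˡ; ∈-++⁺ʳ)
  import Data.List.Properties as Listₚ
  open import Data.List.Relation.Unary.All as All using (All; []; _∷_)
  open import Data.List.Relation.Unary.Any using (here; there)
  open import Data.Nat.Base using (zero; suc)
  open import Data.Nat.Coprimality using (Coprime)
  open import Data.Nat.Logarithm using (⌊log₂_⌋; ⌊log₂[2^n]⌋≡n)
  import Data.Nat.Properties as ℕₚ
  open import Data.Product.Base using (∃; proj₁; proj₂)
  open import Data.Rational.Base as ℚ using (ℚ; mkℚ; 0ℚ; 1ℚ; ½; _+_; _*_; _-_; -_; _≤_; _<_; _/_; Positive; fromℚᵘ; toℚᵘ; ↧ₙ_)
  open import Data.Rational.Properties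
  open import Data.Rational.Solver using (module +-*-Solver)
  import Data.Rational.Unnormalised.Base as ℚᵘ
  import Data.Rational.Unnormalised.Properties as ℚᵘₚ
  open import Data.Sign.Base as Sign using (Sign)
  import Data.Sign.Properties as Signₚ
  open import Data.Sum.Base using (inj₁; inj₂)
  open import Data.Vec.Base using (Vec; []; _∷_; lookup)
  open import Function.Base using (_∘_; id)
  open import Relation.Binary.PropositionalEquality using (_≡_; _≢_; refl; sym; trans; cong; cong₂; subst; subst₂; module ≡-Reasoning)
  open import Relation.Nullary using (yes; no; ¬_; ¬?; Dec; does)
  open import Relation.Unary using (Pred; Decidable)
  import Defs
  open import Defs using (ℝ; seq; ∑; fromℚ; log₂ℕ-approx; 2^⌊log₂n⌋≤n; n<2^[1+⌊log₂n⌋]; log₂; plog1/p)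
  open import Defs using (allVec; Cube; cube; subsets; ⟦_⟧; 𝔼; ℙ; μ; X; BooleanFunction; NonConstant; Inf; totalInf; fourier; Ent)
  open +-*-Solver using (solve; _:=_; _:+_; _:*_; _:-_; :-_; con)

  -- Ordered-field arithmetic

  -- The ring solver proves equations only. An inequality that is another one regrouped is reduced
  -- to an equation between the two differences.
  linear : ∀ {a b p q} → a ≤ b → b - a ≡ q - p → p ≤ q
  linear {a} {b} {p} {q} a≤b eq =
    subst₂ _≤_ (+-identityʳ p) (solve 2 (λ p q → p :+ (q :- p) := q) refl p q)
      (+-monoʳ-≤ p (subst (0ℚ ≤_) eq (subst (_≤ b - a) (+-inverseʳ a) (+-monoˡ-≤ (- a) a≤b))))

  *-nonNeg : ∀ {p q} → 0ℚ ≤ p → 0ℚ ≤ q → 0ℚ ≤ p * q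
  *-nonNeg {p} {q} 0≤p 0≤q =
    nonNegative⁻¹ (p * q) {{nonNeg*nonNeg⇒nonNeg p {{ℚ.nonNegative 0≤p}} q {{ℚ.nonNegative 0≤q}}}}

  *-pos : ∀ {p q} → 0ℚ < p → 0ℚ < q → 0ℚ < p * q
  *-pos {p} {q} 0<p 0<q =
    positive⁻¹ (p * q) {{pos*pos⇒pos p {{ℚ.positive 0<p}} q {{ℚ.positive 0<q}}}}

  0≤p² : ∀ p → 0ℚ ≤ p * p
  0≤p² p with ≤-total 0ℚ p
  ... | inj₁ 0≤p = *-nonNeg 0≤p 0≤p
  ... | inj₂ p≤0 = nonNegative⁻¹ (p * p) {{nonPos*nonPos⇒nonPos p {{ℚ.nonPositive p≤0}} p {{ℚ.nonPositive p≤0}}}}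

  0<1ℚ : 0ℚ < 1ℚ
  0<1ℚ = positive⁻¹ 1ℚ

  +-pos-nonNeg : ∀ {p q} → 0ℚ < p → 0ℚ ≤ q → 0ℚ < p + q
  +-pos-nonNeg {p} {q} 0<p 0≤q = subst (_< p + q) (+-identityʳ 0ℚ) (+-mono-<-≤ 0<p 0≤q)

  fromℚᵘ-homo-+ : ∀ p q → fromℚᵘ (p ℚᵘ.+ q) ≡ fromℚᵘ p + fromℚᵘ q
  fromℚᵘ-homo-+ p q = toℚᵘ-injective (begin
    toℚᵘ (fromℚᵘ (p ℚᵘ.+ q))                ≈⟨ toℚᵘ-fromℚᵘ (p ℚᵘ.+ q) ⟩
    p ℚᵘ.+ q                                ≈⟨ ℚᵘₚ.+-cong (toℚᵘ-fromℚᵘ p) (toℚᵘ-fromℚᵘ q) ⟨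
    toℚᵘ (fromℚᵘ p) ℚᵘ.+ toℚᵘ (fromℚᵘ q)    ≈⟨ toℚᵘ-homo-+ (fromℚᵘ p) (fromℚᵘ q) ⟨
    toℚᵘ (fromℚᵘ p + fromℚᵘ q)              ∎)
    where open import Relation.Binary.Reasoning.Setoid ℚᵘₚ.≃-setoid

  fromℚᵘ-homo-* : ∀ p q → fromℚᵘ (p ℚᵘ.* q) ≡ fromℚᵘ p * fromℚᵘ q
  fromℚᵘ-homo-* p q = toℚᵘ-injective (begin
    toℚᵘ (fromℚᵘ (p ℚᵘ.* q))                ≈⟨ toℚᵘ-fromℚᵘ (p ℚᵘ.* q) ⟩
    p ℚᵘ.* q                                ≈⟨ ℚᵘₚ.*-cong (toℚᵘ-fromℚᵘ p) (toℚᵘ-fromℚᵘ q) ⟨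
    toℚᵘ (fromℚᵘ p) ℚᵘ.* toℚᵘ (fromℚᵘ q)    ≈⟨ toℚᵘ-homo-* (fromℚᵘ p) (fromℚᵘ q) ⟨
    toℚᵘ (fromℚᵘ p * fromℚᵘ q)              ∎)
    where open import Relation.Binary.Reasoning.Setoid ℚᵘₚ.≃-setoid

  -- Abstract, so that conversion checking does not unfold the gcd normalisation inside _/_.
  abstract
    ι : ℕ → ℚ
    ι n = + n / 1

    ι-0 : ι 0 ≡ 0ℚ
    ι-0 = refl

    ι-1 : ι 1 ≡ 1ℚ
    ι-1 = refl

    ι-+ : ∀ m n → ι (m ℕ.+ n) ≡ ι m + ι n
    ι-+ m n = trans (fromℚᵘ-cong {ℚᵘ.mkℚᵘ (+ (m ℕ.+ n)) 0} {ℚᵘ.mkℚᵘ (+ m) 0 ℚᵘ.+ ℚᵘ.mkℚᵘ (+ n) 0} (ℚᵘ.*≡* (cong (ℤ._* + 1)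
        (sym (cong₂ ℤ._+_ (ℤₚ.*-identityʳ (+ m)) (ℤₚ.*-identityʳ (+ n)))))))
      (fromℚᵘ-homo-+ (ℚᵘ.mkℚᵘ (+ m) 0) (ℚᵘ.mkℚᵘ (+ n) 0))

    ι-* : ∀ m n → ι (m ℕ.* n) ≡ ι m * ι n
    ι-* m n = trans (fromℚᵘ-cong {ℚᵘ.mkℚᵘ (+ (m ℕ.* n)) 0} {ℚᵘ.mkℚᵘ (+ m) 0 ℚᵘ.* ℚᵘ.mkℚᵘ (+ n) 0} (ℚᵘ.*≡* (cong (ℤ._* + 1) (ℤₚ.pos-* m n))))
      (fromℚᵘ-homo-* (ℚᵘ.mkℚᵘ (+ m) 0) (ℚᵘ.mkℚᵘ (+ n) 0))

    ι-mono : ∀ {m n} → m ℕ.≤ n → ι m ≤ ι n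
    ι-mono {m} {n} m≤n = toℚᵘ-cancel-≤ (begin
      toℚᵘ (ι m)         ≃⟨ toℚᵘ-fromℚᵘ (ℚᵘ.mkℚᵘ (+ m) 0) ⟩
      ℚᵘ.mkℚᵘ (+ m) 0    ≤⟨ ℚᵘ.*≤* (ℤₚ.*-monoʳ-≤-nonNeg (+ 1) (ℤ.+≤+ m≤n)) ⟩
      ℚᵘ.mkℚᵘ (+ n) 0    ≃⟨ toℚᵘ-fromℚᵘ (ℚᵘ.mkℚᵘ (+ n) 0) ⟨
      toℚᵘ (ι n)         ∎)
      where open ℚᵘₚ.≤-Reasoning

    -- A normalised fraction becomes numerator times reciprocal, a product that the ring solver can
    -- handle.
    +/≡ι* : ∀ a n .{{_ : ℕ.NonZero n}} → + a / n ≡ ι a * (+ 1 / n)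
    +/≡ι* a (suc n) = trans
      (fromℚᵘ-cong {ℚᵘ.mkℚᵘ (+ a) n} {ℚᵘ.mkℚᵘ (+ a) 0 ℚᵘ.* ℚᵘ.mkℚᵘ (+ 1) n} (ℚᵘ.*≡* (cong₂ ℤ._*_ (sym (ℤₚ.*-identityʳ (+ a))) (cong +_ (ℕₚ.+-identityʳ (suc n))))))
      (fromℚᵘ-homo-* (ℚᵘ.mkℚᵘ (+ a) 0) (ℚᵘ.mkℚᵘ (+ 1) n))

    recip : ∀ n → .{{ℕ.NonZero n}} → ℚ
    recip n = + 1 / n

    recip-def : ∀ n .{{_ : ℕ.NonZero n}} → + 1 / n ≡ recip n
    recip-def n = refl

    ι*recip : ∀ n .{{_ : ℕ.NonZero n}} → ι n * recip n ≡ 1ℚ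
    ι*recip n@(suc _) = trans (sym (+/≡ι* n n)) (fromℚᵘ-cong {ℚᵘ.mkℚᵘ (+ n) _} {ℚᵘ.mkℚᵘ (+ 1) 0} (ℚᵘ.*≡* (ℤₚ.*-comm (+ n) (+ 1))))

    0<recip : ∀ n .{{_ : ℕ.NonZero n}} → 0ℚ < recip n
    0<recip n@(suc _) = positive⁻¹ (recip n) {{normalize-pos 1 n}}

    ι-num-den : ∀ n d .(c : Coprime n (suc d)) → mkℚ (+ n) d c * ι (suc d) ≡ ι n
    ι-num-den n d c = begin
      mkℚ (+ n) d c * ι (suc d)              ≡⟨ cong (_* ι (suc d)) (sym (↥p/↧p≡p (mkℚ (+ n) d c))) ⟩
      (+ n / suc d) * ι (suc d)              ≡⟨ cong (_* ι (suc d)) (+/≡ι* n (suc d)) ⟩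
      ι n * recip (suc d) * ι (suc d)        ≡⟨ solve 3 (λ a b c → a :* b :* c := a :* (c :* b)) refl (ι n) (recip (suc d)) (ι (suc d)) ⟩
      ι n * (ι (suc d) * recip (suc d))      ≡⟨ cong (ι n *_) (ι*recip (suc d)) ⟩
      ι n * 1ℚ                               ≡⟨ *-identityʳ (ι n) ⟩
      ι n                                    ∎
      where open ≡-Reasoning

  ι-suc : ∀ n → ι (suc n) ≡ 1ℚ + ι n
  ι-suc n = trans (ι-+ 1 n) (cong (_+ ι n) ι-1)

  0≤ι : ∀ n → 0ℚ ≤ ι n
  0≤ι n = subst (_≤ ι n) ι-0 (ι-mono ℕ.z≤n)

  0<ι : ∀ j .{{_ : ℕ.NonZero j}} → 0ℚ < ι j
  0<ι (suc j) = <-≤-trans 0<1ℚ (subst (_≤ ι (suc j)) ι-1 (ι-mono (ℕ.s≤s ℕ.z≤n)))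

  -- Inequalities of sequences up to O(1/m)

  e : ℕ → ℚ
  e m = recip (suc m)

  infix 4 _≲_

  record _≲_ (u v : ℕ → ℚ) : Set where
    constructor mk≲
    field
      C     : ℚ
      bound : ∀ m → u m ≤ v m + C * e m

  ≤⇒≲ : ∀ {u v} → (∀ m → u m ≤ v m) → u ≲ v
  ≤⇒≲ {u} {v} h = mk≲ 0ℚ λ m →
    linear (h m) (solve 3 (λ u v e → v :- u := v :+ con 0ℚ :* e :- u) refl (u m) (v m) (e m))

  ≲-trans : ∀ {u v w} → u ≲ v → v ≲ w → u ≲ w
  ≲-trans {u} {v} {w} (mk≲ C p) (mk≲ D q) = mk≲ (C + D) λ m →
    linear (+-mono-≤ (p m) (q m))
      (solve 6 (λ u v w C D e → (v :+ C :* e) :+ (w :+ D :* e) :- (u :+ v) := w :+ (C :+ D) :* e :- u) refl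
        (u m) (v m) (w m) C D (e m))

  -- The counterpart of `linear`: the hypotheses are first added up with `+-mono-≲`, and all
  -- cancellation is then done by one ring identity.
  ≲-linear : ∀ {u v u′ v′} → u ≲ v → (∀ m → v m - u m ≡ v′ m - u′ m) → u′ ≲ v′
  ≲-linear {u} {v} {u′} {v′} (mk≲ C p) eq = mk≲ C λ m →
    linear (p m) (trans (shift (u m) (v m) (C * e m)) (trans (cong (_+ C * e m) (eq m)) (sym (shift (u′ m) (v′ m) (C * e m)))))
    where
    shift : ∀ u v c → v + c - u ≡ v - u + c
    shift = solve 3 (λ u v c → v :+ c :- u := v :- u :+ c) refl

  +-mono-≲ : ∀ {u v u′ v′} → u ≲ v → u′ ≲ v′ → (λ m → u m + u′ m) ≲ (λ m → v m + v′ m)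
  +-mono-≲ {u} {v} {u′} {v′} (mk≲ C p) (mk≲ D q) = mk≲ (C + D) λ m →
    linear (+-mono-≤ (p m) (q m))
      (solve 7 (λ u v u′ v′ C D e → (v :+ C :* e) :+ (v′ :+ D :* e) :- (u :+ u′) := (v :+ v′) :+ (C :+ D) :* e :- (u :+ u′)) refl
        (u m) (v m) (u′ m) (v′ m) C D (e m))

  *-mono-≲ : ∀ {p u v} → 0ℚ ≤ p → u ≲ v → (λ m → p * u m) ≲ (λ m → p * v m)
  *-mono-≲ {p} {u} {v} 0≤p (mk≲ C h) = mk≲ (p * C) λ m →
    linear (*-monoˡ-≤-nonNeg p {{ℚ.nonNegative 0≤p}} (h m))
      (solve 5 (λ p u v C e → p :* (v :+ C :* e) :- p :* u := p :* v :+ p :* C :* e :- p :* u) refl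
        p (u m) (v m) C (e m))

  -- Approximate logarithms

  ⌊log₂_^_⌋ : ℕ → ℕ → ℕ
  ⌊log₂ a ^ M ⌋ = ⌊log₂ (a ℕ.^ M) ⌋

  2^-cancel-≤ : ∀ {p q} → 2 ℕ.^ p ℕ.≤ 2 ℕ.^ q → p ℕ.≤ q
  2^-cancel-≤ {p} {q} h = ℕₚ.≮⇒≥ λ q<p →
    ℕₚ.<-irrefl refl (ℕₚ.<-≤-trans (ℕₚ.^-monoʳ-< 2 (ℕ.s≤s (ℕ.s≤s ℕ.z≤n)) q<p) h)

  2^-+-≤ : ∀ {A B x y} → 2 ℕ.^ A ℕ.≤ x → 2 ℕ.^ B ℕ.≤ y → 2 ℕ.^ (A ℕ.+ B) ℕ.≤ x ℕ.* y
  2^-+-≤ {A} {B} p q = subst (ℕ._≤ _) (sym (ℕₚ.^-distribˡ-+-* 2 A B)) (ℕₚ.*-mono-≤ p q)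

  ≤-2^-+ : ∀ {A B x y} → x ℕ.≤ 2 ℕ.^ A → y ℕ.≤ 2 ℕ.^ B → x ℕ.* y ℕ.≤ 2 ℕ.^ (A ℕ.+ B)
  ≤-2^-+ {A} {B} p q = subst (_ ℕ.≤_) (sym (ℕₚ.^-distribˡ-+-* 2 A B)) (ℕₚ.*-mono-≤ p q)

  ^-distribʳ-* : ∀ M a b → (a ℕ.* b) ℕ.^ M ≡ a ℕ.^ M ℕ.* b ℕ.^ M
  ^-distribʳ-* zero    a b = refl
  ^-distribʳ-* (suc M) a b = trans (cong (a ℕ.* b ℕ.*_) (^-distribʳ-* M a b))
    (ℕₚ.[m*n]*[o*p]≡[m*o]*[n*p] a b (a ℕ.^ M) (b ℕ.^ M))

  ^-distrib-*₄ : ∀ M a b c d → (a ℕ.* b ℕ.* (c ℕ.* d)) ℕ.^ M ≡ a ℕ.^ M ℕ.* b ℕ.^ M ℕ.* (c ℕ.^ M ℕ.* d ℕ.^ M)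
  ^-distrib-*₄ M a b c d = trans (^-distribʳ-* M (a ℕ.* b) (c ℕ.* d))
    (cong₂ ℕ._*_ (^-distribʳ-* M a b) (^-distribʳ-* M c d))

  -- Bracket each power x ^ M between 2 ^ ⌊log₂ x ^ M⌋ and twice that number, multiply, and compare
  -- exponents of 2. Four factors occur because cross-multiplying q r ≤ s t yields two numerators
  -- and two denominators on each side. Each upper bracket costs one unit.
  ⌊log₂⌋-mono₄ : ∀ M a b c d a′ b′ c′ d′ .{{_ : ℕ.NonZero a}} .{{_ : ℕ.NonZero b}} .{{_ : ℕ.NonZero c}} .{{_ : ℕ.NonZero d}} →
    a ℕ.* b ℕ.* (c ℕ.* d) ℕ.≤ a′ ℕ.* b′ ℕ.* (c′ ℕ.* d′) →
    ⌊log₂ a ^ M ⌋ ℕ.+ ⌊log₂ b ^ M ⌋ ℕ.+ (⌊log₂ c ^ M ⌋ ℕ.+ ⌊log₂ d ^ M ⌋) ℕ.≤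
    suc ⌊log₂ a′ ^ M ⌋ ℕ.+ suc ⌊log₂ b′ ^ M ⌋ ℕ.+ (suc ⌊log₂ c′ ^ M ⌋ ℕ.+ suc ⌊log₂ d′ ^ M ⌋)
  ⌊log₂⌋-mono₄ M a b c d a′ b′ c′ d′ h = 2^-cancel-≤ (ℕₚ.≤-trans
    (2^-+-≤ {⌊log₂ a ^ M ⌋ ℕ.+ ⌊log₂ b ^ M ⌋} {⌊log₂ c ^ M ⌋ ℕ.+ ⌊log₂ d ^ M ⌋}
      (2^-+-≤ {⌊log₂ a ^ M ⌋} (lower a) (lower b))
      (2^-+-≤ {⌊log₂ c ^ M ⌋} (lower c) (lower d)))
    (ℕₚ.≤-trans
      (subst₂ ℕ._≤_ (^-distrib-*₄ M a b c d) (^-distrib-*₄ M a′ b′ c′ d′) (ℕₚ.^-monoˡ-≤ M h))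
      (≤-2^-+ {suc ⌊log₂ a′ ^ M ⌋ ℕ.+ suc ⌊log₂ b′ ^ M ⌋} {suc ⌊log₂ c′ ^ M ⌋ ℕ.+ suc ⌊log₂ d′ ^ M ⌋}
        (≤-2^-+ {suc ⌊log₂ a′ ^ M ⌋} (upper a′) (upper b′))
        (≤-2^-+ {suc ⌊log₂ c′ ^ M ⌋} (upper c′) (upper d′)))))
    where
    lower : ∀ x .{{_ : ℕ.NonZero x}} → 2 ℕ.^ ⌊log₂ x ^ M ⌋ ℕ.≤ x ℕ.^ M
    lower x = 2^⌊log₂n⌋≤n (x ℕ.^ M) {{ℕₚ.m^n≢0 x M}}
    upper : ∀ x → x ℕ.^ M ℕ.≤ 2 ℕ.^ suc ⌊log₂ x ^ M ⌋
    upper x = ℕₚ.<⇒≤ (n<2^[1+⌊log₂n⌋] (x ℕ.^ M))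

  approx≡ : ∀ a m → log₂ℕ-approx a m ≡ ι ⌊log₂ a ^ suc m ⌋ * e m
  approx≡ a m = trans (+/≡ι* ⌊log₂ a ^ suc m ⌋ (suc m)) (cong (ι ⌊log₂ a ^ suc m ⌋ *_) (recip-def (suc m)))

  -- The approximating sequence of log₂ q, with junk value 0 for q ≤ 0.
  lg : ℚ → ℕ → ℚ
  lg (mkℚ (+ zero) _ _)  m = 0ℚ
  lg (mkℚ +[1+ p ] d _)  m = log₂ℕ-approx (suc p) m - log₂ℕ-approx (suc d) m
  lg (mkℚ -[1+ _ ] _ _)  m = 0ℚ

  -- Two products are compared at once so that a single rounding estimate serves everything: putting
  -- 1 for `r` or for `t` yields the two halves of additivity, each combined with monotonicity.
  lg-*-≤⁺ : ∀ q r s t {{_ : Positive q}} {{_ : Positive r}} {{_ : Positive s}} {{_ : Positive t}} →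
    q * r ≤ s * t → (λ m → lg q m + lg r m) ≲ (λ m → lg s m + lg t m)
  lg-*-≤⁺ q@(mkℚ +[1+ q₁ ] q₂ _) r@(mkℚ +[1+ r₁ ] r₂ _) s@(mkℚ +[1+ s₁ ] s₂ _) t@(mkℚ +[1+ t₁ ] t₂ _) h =
    -- Each of the four floors on the right-hand side costs less than 1/(m+1).
    mk≲ (ι 4) λ m →
      let open ≡-Reasoning
          A = λ a → ⌊log₂ suc a ^ suc m ⌋
          a = λ k → log₂ℕ-approx (suc k) m
          ε = e m
          ι-sum : ∀ w x y z → ι (w ℕ.+ x ℕ.+ (y ℕ.+ z)) ≡ ι w + ι x + (ι y + ι z)
          ι-sum w x y z = trans (ι-+ (w ℕ.+ x) (y ℕ.+ z)) (cong₂ _+_ (ι-+ w x) (ι-+ y z))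
          left : ι (A q₁ ℕ.+ A r₁ ℕ.+ (A s₂ ℕ.+ A t₂)) * ε ≡ a q₁ + a r₁ + (a s₂ + a t₂)
          left = begin
            ι (A q₁ ℕ.+ A r₁ ℕ.+ (A s₂ ℕ.+ A t₂)) * ε
              ≡⟨ cong (_* ε) (ι-sum (A q₁) (A r₁) (A s₂) (A t₂)) ⟩
            (ι (A q₁) + ι (A r₁) + (ι (A s₂) + ι (A t₂))) * ε
              ≡⟨ solve 5 (λ w x y z e → (w :+ x :+ (y :+ z)) :* e := w :* e :+ x :* e :+ (y :* e :+ z :* e)) refl (ι (A q₁)) (ι (A r₁)) (ι (A s₂)) (ι (A t₂)) ε ⟩
            ι (A q₁) * ε + ι (A r₁) * ε + (ι (A s₂) * ε + ι (A t₂) * ε)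
              ≡⟨ cong₂ _+_ (cong₂ _+_ (approx≡ (suc q₁) m) (approx≡ (suc r₁) m)) (cong₂ _+_ (approx≡ (suc s₂) m) (approx≡ (suc t₂) m)) ⟨
            a q₁ + a r₁ + (a s₂ + a t₂) ∎
          right : ι (suc (A s₁) ℕ.+ suc (A t₁) ℕ.+ (suc (A q₂) ℕ.+ suc (A r₂))) * ε ≡ a s₁ + a t₁ + (a q₂ + a r₂) + ι 4 * ε
          right = begin
            ι (suc (A s₁) ℕ.+ suc (A t₁) ℕ.+ (suc (A q₂) ℕ.+ suc (A r₂))) * ε
              ≡⟨ cong (_* ε) (trans (ι-sum (suc (A s₁)) (suc (A t₁)) (suc (A q₂)) (suc (A r₂))) (cong₂ _+_ (cong₂ _+_ (ι-suc (A s₁)) (ι-suc (A t₁))) (cong₂ _+_ (ι-suc (A q₂)) (ι-suc (A r₂))))) ⟩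
            ((1ℚ + ι (A s₁)) + (1ℚ + ι (A t₁)) + ((1ℚ + ι (A q₂)) + (1ℚ + ι (A r₂)))) * ε
              ≡⟨ solve 5 (λ w x y z e → ((con 1ℚ :+ w) :+ (con 1ℚ :+ x) :+ ((con 1ℚ :+ y) :+ (con 1ℚ :+ z))) :* e := w :* e :+ x :* e :+ (y :* e :+ z :* e) :+ (con 1ℚ :+ (con 1ℚ :+ (con 1ℚ :+ con 1ℚ))) :* e) refl (ι (A s₁)) (ι (A t₁)) (ι (A q₂)) (ι (A r₂)) ε ⟩
            ι (A s₁) * ε + ι (A t₁) * ε + (ι (A q₂) * ε + ι (A r₂) * ε) + (1ℚ + (1ℚ + (1ℚ + 1ℚ))) * ε
              ≡⟨ cong₂ _+_ (cong₂ _+_ (cong₂ _+_ (approx≡ (suc s₁) m) (approx≡ (suc t₁) m)) (cong₂ _+_ (approx≡ (suc q₂) m) (approx≡ (suc r₂) m))) (cong (_* ε) ι-4) ⟨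
            a s₁ + a t₁ + (a q₂ + a r₂) + ι 4 * ε ∎
      in linear (subst₂ _≤_ left right
            (*-monoʳ-≤-nonNeg ε {{ℚ.nonNegative (<⇒≤ (0<recip (suc m)))}}
              (ι-mono (⌊log₂⌋-mono₄ (suc m) (suc q₁) (suc r₁) (suc s₂) (suc t₂) (suc s₁) (suc t₁) (suc q₂) (suc r₂) cross))))
          (solve 9 (λ q₁ q₂ r₁ r₂ s₁ s₂ t₁ t₂ c →
              (s₁ :+ t₁ :+ (q₂ :+ r₂) :+ c) :- (q₁ :+ r₁ :+ (s₂ :+ t₂)) :=
              ((s₁ :- s₂) :+ (t₁ :- t₂) :+ c) :- ((q₁ :- q₂) :+ (r₁ :- r₂))) refl
            (a q₁) (a q₂) (a r₁) (a r₂) (a s₁) (a s₂) (a t₁) (a t₂) (ι 4 * ε))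
    where
    ι-4 : ι 4 ≡ 1ℚ + (1ℚ + (1ℚ + 1ℚ))
    ι-4 = trans (ι-suc 3) (cong (λ x → 1ℚ + x) (trans (ι-suc 2) (cong (λ x → 1ℚ + x) (trans (ι-suc 1) (cong (λ x → 1ℚ + x) ι-1)))))
    cross : suc q₁ ℕ.* suc r₁ ℕ.* (suc s₂ ℕ.* suc t₂) ℕ.≤ suc s₁ ℕ.* suc t₁ ℕ.* (suc q₂ ℕ.* suc r₂)
    cross = ℤₚ.drop‿+≤+ (ℚᵘₚ.drop-*≤* (ℚᵘₚ.≤-respˡ-≃ (toℚᵘ-homo-* q r) (ℚᵘₚ.≤-respʳ-≃ (toℚᵘ-homo-* s t) (toℚᵘ-mono-≤ h))))

  lg-1 : ∀ m → lg 1ℚ m ≡ 0ℚ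
  lg-1 m = +-inverseʳ (log₂ℕ-approx 1 m)

  lg-*-≤ : ∀ {q r s t} → 0ℚ < q → 0ℚ < r → 0ℚ < s → 0ℚ < t →
    q * r ≤ s * t → (λ m → lg q m + lg r m) ≲ (λ m → lg s m + lg t m)
  lg-*-≤ {q} {r} {s} {t} 0<q 0<r 0<s 0<t =
    lg-*-≤⁺ q r s t {{ℚ.positive 0<q}} {{ℚ.positive 0<r}} {{ℚ.positive 0<s}} {{ℚ.positive 0<t}}

  lg-*-≲ : ∀ {q s t} → 0ℚ < q → 0ℚ < s → 0ℚ < t → q ≤ s * t → lg q ≲ (λ m → lg s m + lg t m)
  lg-*-≲ {q} {s} {t} 0<q 0<s 0<t h = ≲-linear
    (lg-*-≤ 0<q 0<1ℚ 0<s 0<t (subst (_≤ s * t) (sym (*-identityʳ q)) h))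
    λ m → trans (cong (λ z → lg s m + lg t m - (lg q m + z)) (lg-1 m))
      (cong (λ z → lg s m + lg t m - z) (+-identityʳ (lg q m)))

  lg-*-≳ : ∀ {q s t} → 0ℚ < q → 0ℚ < s → 0ℚ < t → s * t ≤ q → (λ m → lg s m + lg t m) ≲ lg q
  lg-*-≳ {q} {s} {t} 0<q 0<s 0<t h = ≲-linear
    (lg-*-≤ 0<s 0<t 0<q 0<1ℚ (subst (s * t ≤_) (sym (*-identityʳ q)) h))
    λ m → trans (cong (λ z → lg q m + z - (lg s m + lg t m)) (lg-1 m))
      (cong (_- (lg s m + lg t m)) (+-identityʳ (lg q m)))

  -- The approximations of log₂ 2 are exactly 1, because the floor of log₂ 2^(m+1) is exact; those
  -- of log₂ 1 need only be nonnegative.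
  -1≲lg-½ : (λ _ → - 1ℚ) ≲ lg ½
  -1≲lg-½ = ≤⇒≲ λ m →
    linear (subst (0ℚ ≤_) (sym (approx≡ 1 m)) (*-nonNeg (0≤ι ⌊log₂ 1 ^ suc m ⌋) (<⇒≤ (0<recip (suc m)))))
      (trans (solve 1 (λ x → x :- con 0ℚ := x :- con 1ℚ :- (:- con 1ℚ)) refl (log₂ℕ-approx 1 m))
        (cong (λ z → log₂ℕ-approx 1 m - z - (- 1ℚ)) (sym (approx-2 m))))
    where
    approx-2 : ∀ m → log₂ℕ-approx 2 m ≡ 1ℚ
    approx-2 m = trans (approx≡ 2 m) (trans (cong (λ z → ι z * e m) (⌊log₂[2^n]⌋≡n (suc m))) (ι*recip (suc m)))

  -- The chord bound for log₂ on multiples of 1/K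

  module Tangent (K : ℕ) {{K≢0 : ℕ.NonZero K}} where

    κ : ℚ
    κ = recip K

    0<κ : 0ℚ < κ
    0<κ = 0<recip K

    0<1+κ : 0ℚ < 1ℚ + κ
    0<1+κ = +-pos-nonNeg 0<1ℚ (<⇒≤ 0<κ)

    δ : ℕ → ℚ
    δ = lg (1ℚ + κ)

    0<ι*κ : ∀ j .{{_ : ℕ.NonZero j}} → 0ℚ < ι j * κ
    0<ι*κ j = *-pos (0<ι j) 0<κ

    -- log increments over steps of length κ decrease, and the increment at 1 is δ;
    -- so log lies below the chord of slope K δ on either side of 1.
    difference : ∀ j → ι j * κ * (1ℚ + κ) - ι (suc j) * κ ≡ κ * κ * (ι j - ι K)
    difference j = begin
      ι j * κ * (1ℚ + κ) - ι (suc j) * κ        ≡⟨ cong (λ z → ι j * κ * (1ℚ + κ) - z * κ) (ι-suc j) ⟩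
      ι j * κ * (1ℚ + κ) - (1ℚ + ι j) * κ       ≡⟨ solve 2 (λ j κ → j :* κ :* (con 1ℚ :+ κ) :- (con 1ℚ :+ j) :* κ := κ :* κ :* j :- κ :* con 1ℚ) refl (ι j) κ ⟩
      κ * κ * ι j - κ * 1ℚ                      ≡⟨ cong (λ z → κ * κ * ι j - κ * z) (sym (ι*recip K)) ⟩
      κ * κ * ι j - κ * (ι K * κ)               ≡⟨ solve 3 (λ j κ k → κ :* κ :* j :- κ :* (k :* κ) := κ :* κ :* (j :- k)) refl (ι j) κ (ι K) ⟩
      κ * κ * (ι j - ι K)                       ∎
      where open ≡-Reasoning

    step-up : ∀ j .{{_ : ℕ.NonZero j}} → K ℕ.≤ j → lg (ι (suc j) * κ) ≲ (λ m → lg (ι j * κ) m + δ m)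
    step-up j K≤j = lg-*-≲ (0<ι*κ (suc j)) (0<ι*κ j) 0<1+κ
      (linear (*-monoˡ-≤-nonNeg (κ * κ) {{ℚ.nonNegative (0≤p² κ)}} (ι-mono K≤j))
        (trans (solve 3 (λ k j κ → κ :* κ :* j :- κ :* κ :* k := κ :* κ :* (j :- k)) refl (ι K) (ι j) κ) (sym (difference j))))

    step-down : ∀ j .{{_ : ℕ.NonZero j}} → j ℕ.≤ K → (λ m → lg (ι j * κ) m + δ m) ≲ lg (ι (suc j) * κ)
    step-down j j≤K = lg-*-≳ (0<ι*κ (suc j)) (0<ι*κ j) 0<1+κ
      (linear (*-monoˡ-≤-nonNeg (κ * κ) {{ℚ.nonNegative (0≤p² κ)}} (ι-mono j≤K))
        (trans (solve 3 (λ k j κ → κ :* κ :* k :- κ :* κ :* j := :- (κ :* κ :* (j :- k))) refl (ι K) (ι j) κ)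
          (trans (cong -_ (sym (difference j)))
            (solve 2 (λ a b → :- (a :- b) := b :- a) refl (ι j * κ * (1ℚ + κ)) (ι (suc j) * κ)))))

    at-K : lg (ι K * κ) ≲ (λ m → (ι K - ι K) * δ m)
    at-K = ≤⇒≲ λ m → ≤-reflexive (trans (cong (λ q → lg q m) (ι*recip K)) (trans (lg-1 m)
      (solve 2 (λ k d → con 0ℚ := (k :- k) :* d) refl (ι K) (δ m))))

    above : ∀ i → lg (ι (i ℕ.+ K) * κ) ≲ (λ m → (ι (i ℕ.+ K) - ι K) * δ m)
    above zero = at-K
    above (suc i) = ≲-linear (+-mono-≲ (step-up (i ℕ.+ K) {{i+K≢0}} (ℕₚ.m≤n+m K i)) (above i)) λ m →
      trans (solve 5 (λ x y j k d → (y :+ d) :+ (j :- k) :* d :- (x :+ y) := ((con 1ℚ :+ j) :- k) :* d :- x) refl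
          (lg (ι (suc i ℕ.+ K) * κ) m) (lg (ι (i ℕ.+ K) * κ) m) (ι (i ℕ.+ K)) (ι K) (δ m))
        (cong (λ z → (z - ι K) * δ m - lg (ι (suc i ℕ.+ K) * κ) m) (sym (ι-suc (i ℕ.+ K))))
      where
      i+K≢0 : ℕ.NonZero (i ℕ.+ K)
      i+K≢0 = ℕ.>-nonZero (ℕₚ.<-≤-trans (ℕ.>-nonZero⁻¹ K) (ℕₚ.m≤n+m K i))

    -- The increments are telescoped away from 1, where the logarithm is 0, so `i` measures the
    -- distance from `j` up to `K`. Left of 1 the increments are at least δ, hence subtracting δ at
    -- each step down bounds the logarithm from above.
    below : ∀ i j .{{_ : ℕ.NonZero j}} → i ℕ.+ j ≡ K → lg (ι j * κ) ≲ (λ m → (ι j - ι K) * δ m)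
    below zero    j refl = at-K
    below (suc i) j eq   = ≲-linear (+-mono-≲ (step-down j (subst (j ℕ.≤_) eq (ℕₚ.m≤n+m j (suc i)))) (below i (suc j) (trans (ℕₚ.+-suc i j) eq))) λ m →
      trans (cong (λ z → lg (ι (suc j) * κ) m + (z - ι K) * δ m - (lg (ι j * κ) m + δ m + lg (ι (suc j) * κ) m)) (ι-suc j))
        (solve 5 (λ x y j k d → x :+ ((con 1ℚ :+ j) :- k) :* d :- (y :+ d :+ x) := (j :- k) :* d :- y) refl
          (lg (ι (suc j) * κ) m) (lg (ι j * κ) m) (ι j) (ι K) (δ m))

    at-multiple : ∀ j .{{_ : ℕ.NonZero j}} → lg (ι j * κ) ≲ (λ m → (ι j - ι K) * δ m)
    at-multiple j with ℕₚ.≤-total K j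
    ... | inj₁ K≤j = subst (λ j → lg (ι j * κ) ≲ (λ m → (ι j - ι K) * δ m)) (ℕₚ.m∸n+n≡m K≤j) (above (j ℕ.∸ K))
    ... | inj₂ j≤K = below (K ℕ.∸ j) j (ℕₚ.m∸n+n≡m j≤K)

    σ : ℕ → ℚ
    σ m = ι K * δ m

    -- Used in Gibbs' inequality at the sets S with P(S) = 0, where the term Q(S) σ remains on the
    -- right-hand side.
    0≲σ : (λ _ → 0ℚ) ≲ σ
    0≲σ = ≲-linear (*-mono-≲ (0≤ι K) (lg-*-≳ 0<1+κ 0<1ℚ 0<1ℚ
        (linear (<⇒≤ 0<κ) (solve 1 (λ κ → κ :- con 0ℚ := con 1ℚ :+ κ :- con 1ℚ) refl κ))))
      λ m → trans (cong (λ z → ι K * δ m - ι K * (z + z)) (lg-1 m))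
        (solve 2 (λ k d → k :* d :- k :* (con 0ℚ :+ con 0ℚ) := k :* d :- con 0ℚ) refl (ι K) (δ m))

    lg-tangent : ∀ {t} j → 0ℚ < t → t * ι K ≡ ι j → lg t ≲ (λ m → (t - 1ℚ) * σ m)
    lg-tangent {t} zero 0<t eq = ⊥-elim (<-irrefl (sym (trans eq ι-0)) (*-pos 0<t (0<ι K)))
    lg-tangent {t} j@(suc _) 0<t eq = subst (λ t → lg t ≲ (λ m → (t - 1ℚ) * σ m)) jκ≡t
      (≲-linear (at-multiple j) λ m → cong (_- lg (ι j * κ) m) (slope m))
      where
      open ≡-Reasoning
      jκ≡t : ι j * κ ≡ t
      jκ≡t = begin
        ι j * κ           ≡⟨ cong (_* κ) (sym eq) ⟩
        t * ι K * κ       ≡⟨ *-assoc t (ι K) κ ⟩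
        t * (ι K * κ)     ≡⟨ cong (t *_) (ι*recip K) ⟩
        t * 1ℚ            ≡⟨ *-identityʳ t ⟩
        t                 ∎
      slope : ∀ m → (ι j - ι K) * δ m ≡ (ι j * κ - 1ℚ) * σ m
      slope m = begin
        (ι j - ι K) * δ m                    ≡⟨ solve 3 (λ j k d → (j :- k) :* d := (j :* con 1ℚ :- k) :* d) refl (ι j) (ι K) (δ m) ⟩
        (ι j * 1ℚ - ι K) * δ m               ≡⟨ cong (λ z → (ι j * z - ι K) * δ m) (sym (ι*recip K)) ⟩
        (ι j * (ι K * κ) - ι K) * δ m        ≡⟨ solve 4 (λ j k κ d → (j :* (k :* κ) :- k) :* d := (j :* κ :- con 1ℚ) :* (k :* d)) refl (ι j) (ι K) κ (δ m) ⟩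
        (ι j * κ - 1ℚ) * σ m                 ∎

    σ≲2 : ∀ j → ½ * ι K ≡ ι j → σ ≲ (λ _ → 1ℚ + 1ℚ)
    σ≲2 j eq = ≲-linear (*-mono-≲ {1ℚ + 1ℚ} (nonNegative⁻¹ (1ℚ + 1ℚ)) (≲-trans -1≲lg-½ (lg-tangent j (positive⁻¹ ½) eq)))
      λ m → solve 1 (λ s → con (1ℚ + 1ℚ) :* (con (½ - 1ℚ) :* s) :- con (1ℚ + 1ℚ) :* con (- 1ℚ) := con (1ℚ + 1ℚ) :- s) refl (σ m)

  -- Common denominators

  Clears : ℕ → ℚ → Set
  Clears K t = ∃ λ j → t * ι K ≡ ι j

  clears-* : ∀ M K t → Clears K t → Clears (M ℕ.* K) t
  clears-* M K t (j , eq) = M ℕ.* j , (begin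
    t * ι (M ℕ.* K)      ≡⟨ cong (t *_) (ι-* M K) ⟩
    t * (ι M * ι K)      ≡⟨ solve 3 (λ t m k → t :* (m :* k) := m :* (t :* k)) refl t (ι M) (ι K) ⟩
    ι M * (t * ι K)      ≡⟨ cong (ι M *_) eq ⟩
    ι M * ι j            ≡⟨ ι-* M j ⟨
    ι (M ℕ.* j)          ∎)
    where open ≡-Reasoning

  denominator-clears : ∀ t → 0ℚ < t → Clears (↧ₙ t) t
  denominator-clears t 0<t = clears t {{ℚ.positive 0<t}}
    where
    clears : ∀ t {{_ : Positive t}} → Clears (↧ₙ t) t
    clears (mkℚ +[1+ n ] d c) = suc n , ι-num-den (suc n) d c

  ½-clears-2 : Clears 2 ½
  ½-clears-2 = 1 , trans (cong (½ *_) (trans (ι-suc 1) (cong (λ z → 1ℚ + z) ι-1))) (sym ι-1)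

  -- The product starts at 2 so that ½ is also a multiple of 1/K; this gives σ ≤ 2.
  evenDenominator : List ℚ → ℕ
  evenDenominator = foldr (λ t K → ↧ₙ t ℕ.* K) 2

  evenDenominator≢0 : ∀ ts → ℕ.NonZero (evenDenominator ts)
  evenDenominator≢0 []                  = _
  evenDenominator≢0 (mkℚ _ d _ ∷ ts) = ℕₚ.m*n≢0 (suc d) (evenDenominator ts) {{_}} {{evenDenominator≢0 ts}}

  ½-clears-even : ∀ ts → Clears (evenDenominator ts) ½
  ½-clears-even []       = ½-clears-2
  ½-clears-even (t ∷ ts) = clears-* (↧ₙ t) (evenDenominator ts) ½ (½-clears-even ts)

  evenDenominator-clears : ∀ ts → All (λ t → 0ℚ < t → Clears (evenDenominator ts) t) ts
  evenDenominator-clears []       = []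
  evenDenominator-clears (t ∷ ts) =
    (λ 0<t → subst (λ K → Clears K t) (ℕₚ.*-comm D (↧ₙ t)) (clears-* D (↧ₙ t) t (denominator-clears t 0<t))) ∷
    All.map (λ {s} h 0<s → clears-* (↧ₙ t) D s (h 0<s)) (evenDenominator-clears ts)
    where D = evenDenominator ts

  -- From here on K is hidden. One σ has to serve all of `ts`, because the σ-terms cancel only after
  -- summation over all subsets.
  record TangentSlope (ts : List ℚ) : Set where
    field
      σ       : ℕ → ℚ
      0≲σ     : (λ _ → 0ℚ) ≲ σ
      σ≲2     : σ ≲ (λ _ → 1ℚ + 1ℚ)
      tangent : All (λ t → 0ℚ < t → lg t ≲ (λ m → (t - 1ℚ) * σ m)) ts

  tangentSlope : ∀ ts → TangentSlope ts
  tangentSlope ts = record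
    { σ       = T.σ
    ; 0≲σ     = T.0≲σ
    ; σ≲2     = let j , eq = ½-clears-even ts in T.σ≲2 j eq
    ; tangent = All.map (λ h 0<t → T.lg-tangent (proj₁ (h 0<t)) 0<t (proj₂ (h 0<t))) (evenDenominator-clears ts)
    }
    where module T = Tangent (evenDenominator ts) {{evenDenominator≢0 ts}}

  -- Finite sums

  private variable
    A B : Set

  Σℚ : List A → (A → ℚ) → ℚ
  Σℚ xs g = foldr _+_ 0ℚ (map g xs)

  Σ-cong : ∀ (xs : List A) {f g : A → ℚ} → (∀ x → f x ≡ g x) → Σℚ xs f ≡ Σℚ xs g
  Σ-cong []       h = refl
  Σ-cong (x ∷ xs) h = cong₂ _+_ (h x) (Σ-cong xs h)

  Σ-+ : ∀ (xs : List A) (f g : A → ℚ) → Σℚ xs (λ x → f x + g x) ≡ Σℚ xs f + Σℚ xs g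
  Σ-+ []       f g = refl
  Σ-+ (x ∷ xs) f g = trans (cong (λ z → f x + g x + z) (Σ-+ xs f g))
    (solve 4 (λ a b c d → a :+ b :+ (c :+ d) := (a :+ c) :+ (b :+ d)) refl (f x) (g x) (Σℚ xs f) (Σℚ xs g))

  Σ-*ˡ : ∀ (xs : List A) c (f : A → ℚ) → Σℚ xs (λ x → c * f x) ≡ c * Σℚ xs f
  Σ-*ˡ []       c f = sym (*-zeroʳ c)
  Σ-*ˡ (x ∷ xs) c f = trans (cong (λ z → c * f x + z) (Σ-*ˡ xs c f)) (sym (*-distribˡ-+ c (f x) (Σℚ xs f)))

  Σ-*ʳ : ∀ (xs : List A) c (f : A → ℚ) → Σℚ xs (λ x → f x * c) ≡ Σℚ xs f * c
  Σ-*ʳ xs c f = trans (Σ-cong xs (λ x → *-comm (f x) c)) (trans (Σ-*ˡ xs c f) (*-comm c (Σℚ xs f)))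

  Σ-neg : ∀ (xs : List A) (f : A → ℚ) → Σℚ xs (λ x → - f x) ≡ - Σℚ xs f
  Σ-neg []       f = refl
  Σ-neg (x ∷ xs) f = trans (cong (λ z → - f x + z) (Σ-neg xs f)) (sym (neg-distrib-+ (f x) (Σℚ xs f)))

  Σ-- : ∀ (xs : List A) (f g : A → ℚ) → Σℚ xs (λ x → f x - g x) ≡ Σℚ xs f - Σℚ xs g
  Σ-- xs f g = trans (Σ-+ xs f (λ x → - g x)) (cong (λ z → Σℚ xs f + z) (Σ-neg xs g))

  Σ-0 : ∀ (xs : List A) → Σℚ xs (λ _ → 0ℚ) ≡ 0ℚ
  Σ-0 []       = refl
  Σ-0 (x ∷ xs) = trans (+-identityˡ _) (Σ-0 xs)

  Σ-swap : ∀ (xs : List A) (ys : List B) (f : A → B → ℚ) →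
    Σℚ xs (λ x → Σℚ ys (f x)) ≡ Σℚ ys (λ y → Σℚ xs (λ x → f x y))
  Σ-swap []       ys f = sym (Σ-0 ys)
  Σ-swap (x ∷ xs) ys f = trans (cong (λ z → Σℚ ys (f x) + z) (Σ-swap xs ys f))
    (sym (Σ-+ ys (f x) (λ y → Σℚ xs (λ x → f x y))))

  Σ-++ : ∀ (xs ys : List A) (f : A → ℚ) → Σℚ (xs ++ ys) f ≡ Σℚ xs f + Σℚ ys f
  Σ-++ []       ys f = sym (+-identityˡ (Σℚ ys f))
  Σ-++ (x ∷ xs) ys f = trans (cong (λ z → f x + z) (Σ-++ xs ys f)) (sym (+-assoc (f x) (Σℚ xs f) (Σℚ ys f)))

  Σ-map : ∀ (xs : List A) (h : A → B) (f : B → ℚ) → Σℚ (map h xs) f ≡ Σℚ xs (f ∘ h)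
  Σ-map xs h f = cong (foldr _+_ 0ℚ) (sym (Listₚ.map-∘ xs))

  Σ-nonNeg : ∀ (xs : List A) {f : A → ℚ} → (∀ x → 0ℚ ≤ f x) → 0ℚ ≤ Σℚ xs f
  Σ-nonNeg []       h = ≤-refl
  Σ-nonNeg (x ∷ xs) h = +-mono-≤ (h x) (Σ-nonNeg xs h)

  Σ-≥-term : ∀ {xs : List A} {f : A → ℚ} → (∀ x → 0ℚ ≤ f x) → ∀ {x} → x ∈ xs → f x ≤ Σℚ xs f
  Σ-≥-term {xs = x ∷ xs} {f} h (here refl) = subst (_≤ f x + Σℚ xs f) (+-identityʳ (f x)) (+-monoʳ-≤ (f x) (Σ-nonNeg xs h))
  Σ-≥-term {xs = x ∷ xs} {f} h {y} (there i) = subst (_≤ f x + Σℚ xs f) (+-identityˡ (f y)) (+-mono-≤ (h x) (Σ-≥-term h i))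

  Σ-mono-≲ : ∀ (xs : List A) {u v : A → ℕ → ℚ} → (∀ x → u x ≲ v x) → (λ m → Σℚ xs (λ x → u x m)) ≲ (λ m → Σℚ xs (λ x → v x m))
  Σ-mono-≲ []       h = ≤⇒≲ λ _ → ≤-refl
  Σ-mono-≲ (x ∷ xs) h = +-mono-≲ (h x) (Σ-mono-≲ xs h)

  Σ-allFin : ∀ n (f : Fin (suc n) → ℚ) → Σℚ (allFin (suc n)) f ≡ f zero + Σℚ (allFin n) (f ∘ suc)
  Σ-allFin n f = cong (λ ks → f zero + foldr _+_ 0ℚ ks)
    (trans (Listₚ.map-tabulate suc f) (sym (Listₚ.map-tabulate id (f ∘ suc))))

  Σ-allVec : ∀ n (a b : A) (f : Vec A (suc n) → ℚ) →
    Σℚ (allVec (a ∷ b ∷ []) (suc n)) f ≡ Σℚ (allVec (a ∷ b ∷ []) n) (f ∘ (a ∷_)) + Σℚ (allVec (a ∷ b ∷ []) n) (f ∘ (b ∷_))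
  Σ-allVec n a b f = begin
    Σℚ (map (a ∷_) vs ++ (map (b ∷_) vs ++ [])) f           ≡⟨ Σ-++ (map (a ∷_) vs) _ f ⟩
    Σℚ (map (a ∷_) vs) f + Σℚ (map (b ∷_) vs ++ []) f       ≡⟨ cong (λ zs → Σℚ (map (a ∷_) vs) f + Σℚ zs f) (Listₚ.++-identityʳ (map (b ∷_) vs)) ⟩
    Σℚ (map (a ∷_) vs) f + Σℚ (map (b ∷_) vs) f             ≡⟨ cong₂ _+_ (Σ-map vs (a ∷_) f) (Σ-map vs (b ∷_) f) ⟩
    Σℚ vs (f ∘ (a ∷_)) + Σℚ vs (f ∘ (b ∷_))                 ∎
    where
    open ≡-Reasoning
    vs = allVec (a ∷ b ∷ []) n

  ∈-allVec : ∀ {xs : List A} → (∀ x → x ∈ xs) → ∀ {n} (v : Vec A n) → v ∈ allVec xs n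
  ∈-allVec h []      = here refl
  ∈-allVec h (x ∷ v) = ∈-cartesianProductWith⁺ _∷_ (h x) (∈-allVec h v)

  ∈-subsets : ∀ {n} (S : Subset n) → S ∈ subsets n
  ∈-subsets = ∈-allVec λ { false → here refl ; true → there (here refl) }

  -- Subadditivity of entropy

  bit : Bool → ℚ
  bit false = 0ℚ
  bit true  = 1ℚ

  0≤bit : ∀ b → 0ℚ ≤ bit b
  0≤bit false = ≤-refl
  0≤bit true  = <⇒≤ 0<1ℚ

  -- With w k = 1/(1 + p k) this is the law of a random set that contains each k independently with
  -- odds p k : 1.
  weight : ∀ {n} → (p w : Fin n → ℚ) → Subset n → ℚ
  weight p w []          = 1ℚ
  weight p w (false ∷ S) = w zero * weight (p ∘ suc) (w ∘ suc) S
  weight p w (true  ∷ S) = w zero * p zero * weight (p ∘ suc) (w ∘ suc) S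

  Σ-weight : ∀ {n} (p w : Fin n → ℚ) → (∀ k → w k * (1ℚ + p k) ≡ 1ℚ) → Σℚ (subsets n) (weight p w) ≡ 1ℚ
  Σ-weight {zero}  p w h = refl
  Σ-weight {suc n} p w h = begin
    Σℚ (subsets (suc n)) (weight p w)                      ≡⟨ Σ-allVec n false true (weight p w) ⟩
    Σℚ (subsets n) (λ S → w zero * W S) + Σℚ (subsets n) (λ S → w zero * p zero * W S)
                                                           ≡⟨ cong₂ _+_ (Σ-*ˡ (subsets n) (w zero) W) (Σ-*ˡ (subsets n) (w zero * p zero) W) ⟩
    w zero * Σℚ (subsets n) W + w zero * p zero * Σℚ (subsets n) W
                                                           ≡⟨ cong (λ z → w zero * z + w zero * p zero * z) (Σ-weight (p ∘ suc) (w ∘ suc) (h ∘ suc)) ⟩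
    w zero * 1ℚ + w zero * p zero * 1ℚ                     ≡⟨ solve 2 (λ w p → w :* con 1ℚ :+ w :* p :* con 1ℚ := w :* (con 1ℚ :+ p)) refl (w zero) (p zero) ⟩
    w zero * (1ℚ + p zero)                                 ≡⟨ h zero ⟩
    1ℚ                                                     ∎
    where
    open ≡-Reasoning
    W = weight (p ∘ suc) (w ∘ suc)

  weight-pos : ∀ {n} (p w : Fin n → ℚ) (S : Subset n) → (∀ k → 0ℚ < w k) → (∀ k → lookup S k ≡ true → 0ℚ < p k) → 0ℚ < weight p w S
  weight-pos p w []          0<w 0<p = 0<1ℚ
  weight-pos p w (false ∷ S) 0<w 0<p = *-pos (0<w zero) (weight-pos _ _ S (0<w ∘ suc) (0<p ∘ suc))
  weight-pos p w (true  ∷ S) 0<w 0<p = *-pos (*-pos (0<w zero) (0<p zero refl)) (weight-pos _ _ S (0<w ∘ suc) (0<p ∘ suc))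

  weight-nonNeg : ∀ {n} (p w : Fin n → ℚ) (S : Subset n) → (∀ k → 0ℚ ≤ w k) → (∀ k → 0ℚ ≤ p k) → 0ℚ ≤ weight p w S
  weight-nonNeg p w []          0≤w 0≤p = <⇒≤ 0<1ℚ
  weight-nonNeg p w (false ∷ S) 0≤w 0≤p = *-nonNeg (0≤w zero) (weight-nonNeg _ _ S (0≤w ∘ suc) (0≤p ∘ suc))
  weight-nonNeg p w (true  ∷ S) 0≤w 0≤p = *-nonNeg (*-nonNeg (0≤w zero) (0≤p zero)) (weight-nonNeg _ _ S (0≤w ∘ suc) (0≤p ∘ suc))

  -- The logarithm of `weight`, written linearly in the indicators of k ∈ S so that averaging over S
  -- produces marginals. The factor `bit` also removes `lg (p k)` for k outside S, where p k may be
  -- 0.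
  lgWeight : ∀ {n} → (p w : Fin n → ℚ) → Subset n → ℕ → ℚ
  lgWeight {n} p w S m = Σℚ (allFin n) λ k → lg (w k) m + bit (lookup S k) * lg (p k) m

  lgWeight-≲ : ∀ {n} (p w : Fin n → ℚ) (S : Subset n) → (∀ k → 0ℚ < w k) → (∀ k → lookup S k ≡ true → 0ℚ < p k) →
    lgWeight p w S ≲ lg (weight p w S)
  lgWeight-≲ p w [] 0<w 0<p = ≤⇒≲ λ m → ≤-reflexive (sym (lg-1 m))
  lgWeight-≲ {suc n} p w (false ∷ S) 0<w 0<p =
    ≲-linear (+-mono-≲ (lg-*-≳ (*-pos (0<w zero) 0<W) (0<w zero) 0<W ≤-refl) (lgWeight-≲ (p ∘ suc) (w ∘ suc) S (0<w ∘ suc) (0<p ∘ suc)))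
      λ m → trans
        (solve 5 (λ q w W L p → (q :+ W) :- (w :+ W :+ L) := q :- ((w :+ con 0ℚ :* p) :+ L)) refl
          (lg (weight p w (false ∷ S)) m) (lg (w zero) m) (lg (weight (p ∘ suc) (w ∘ suc) S) m) (lgWeight (p ∘ suc) (w ∘ suc) S m) (lg (p zero) m))
        (cong (λ z → lg (weight p w (false ∷ S)) m - z) (sym (Σ-allFin n λ k → lg (w k) m + bit (lookup (false ∷ S) k) * lg (p k) m)))
    where 0<W = weight-pos (p ∘ suc) (w ∘ suc) S (0<w ∘ suc) (0<p ∘ suc)
  lgWeight-≲ {suc n} p w (true ∷ S) 0<w 0<p =
    ≲-linear (+-mono-≲ (+-mono-≲ (lg-*-≳ (*-pos 0<wp 0<W) 0<wp 0<W ≤-refl) (lg-*-≳ 0<wp (0<w zero) (0<p zero refl) ≤-refl))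
        (lgWeight-≲ (p ∘ suc) (w ∘ suc) S (0<w ∘ suc) (0<p ∘ suc)))
      λ m → trans
        (solve 6 (λ q w W L p wp → (q :+ wp :+ W) :- (wp :+ W :+ (w :+ p) :+ L) := q :- ((w :+ con 1ℚ :* p) :+ L)) refl
          (lg (weight p w (true ∷ S)) m) (lg (w zero) m) (lg (weight (p ∘ suc) (w ∘ suc) S) m) (lgWeight (p ∘ suc) (w ∘ suc) S m) (lg (p zero) m) (lg (w zero * p zero) m))
        (cong (λ z → lg (weight p w (true ∷ S)) m - z) (sym (Σ-allFin n λ k → lg (w k) m + bit (lookup (true ∷ S) k) * lg (p k) m)))
    where
    0<W = weight-pos (p ∘ suc) (w ∘ suc) S (0<w ∘ suc) (0<p ∘ suc)
    0<wp = *-pos (0<w zero) (0<p zero refl)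

  inverse : ∀ p → 0ℚ < p → ∃ λ r → 0ℚ < r × r * p ≡ 1ℚ
  inverse p 0<p = r , positive⁻¹ r {{1/pos⇒pos p {{ℚ.positive 0<p}}}} , *-inverseˡ p {{pos⇒nonZero p {{ℚ.positive 0<p}}}}
    where
    r : ℚ
    r = (ℚ.1/ p) {{pos⇒nonZero p {{ℚ.positive 0<p}}}}

  -- q / p, with junk value 0 for p ≤ 0.
  ratio : ℚ → ℚ → ℚ
  ratio q p with 0ℚ <? p
  ... | yes 0<p = q * proj₁ (inverse p 0<p)
  ... | no _    = 0ℚ

  ratio-* : ∀ q p → 0ℚ < p → ratio q p * p ≡ q
  ratio-* q p 0<p with 0ℚ <? p
  ... | yes 0<p′ = let r , _ , rp≡1 = inverse p 0<p′ in
    trans (*-assoc q r p) (trans (cong (q *_) rp≡1) (*-identityʳ q))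
  ... | no ≮ = ⊥-elim (≮ 0<p)

  ratio-pos : ∀ q p → 0ℚ < q → 0ℚ < p → 0ℚ < ratio q p
  ratio-pos q p 0<q 0<p with 0ℚ <? p
  ... | yes 0<p′ = *-pos 0<q (proj₁ (proj₂ (inverse p 0<p′)))
  ... | no ≮ = ⊥-elim (≮ 0<p)

  nonNeg∧≮⇒0 : ∀ {p} → 0ℚ ≤ p → ¬ (0ℚ < p) → p ≡ 0ℚ
  nonNeg∧≮⇒0 0≤p ≮ = ≤-antisym (≮⇒≥ ≮) 0≤p

  module _ {σ : ℕ → ℚ} (0≲σ : (λ _ → 0ℚ) ≲ σ) where

    -- For p > 0 let t = q/p. Then L ≤ log q ≤ log t + log p and log t ≤ (t - 1) σ; multiplying by p
    -- gives the claim, since p t = q. For p = 0 the left side is 0 and the right side is q σ. `L`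
    -- stands for any lower bound of log q, here the expanded logarithm of the weight.
    gibbs-term : ∀ {p q} {L : ℕ → ℚ} → 0ℚ ≤ p → 0ℚ ≤ q →
      (0ℚ < p → 0ℚ < q × L ≲ lg q) →
      (0ℚ < ratio q p → lg (ratio q p) ≲ (λ m → (ratio q p - 1ℚ) * σ m)) →
      (λ m → - (p * lg p m)) ≲ (λ m → (q - p) * σ m - p * L m)
    gibbs-term {p} {q} {L} 0≤p 0≤q pos tangent = term (0ℚ <? p)
      where
      term : Dec (0ℚ < p) → (λ m → - (p * lg p m)) ≲ (λ m → (q - p) * σ m - p * L m)
      term (no ≮) = subst (λ p → (λ m → - (p * lg p m)) ≲ (λ m → (q - p) * σ m - p * L m)) (sym (nonNeg∧≮⇒0 0≤p ≮))
        (≲-linear (*-mono-≲ 0≤q 0≲σ) λ m →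
          solve 3 (λ q s L → q :* s :- q :* con 0ℚ := ((q :- con 0ℚ) :* s :- con 0ℚ :* L) :- (:- (con 0ℚ :* con 0ℚ))) refl q (σ m) (L m))
      term (yes 0<p) =
        ≲-linear (*-mono-≲ 0≤p (+-mono-≲ (+-mono-≲ (proj₂ (pos 0<p)) (lg-*-≲ 0<q 0<t 0<p (≤-reflexive (sym tp≡q)))) (tangent 0<t)))
        λ m → trans
          (solve 7 (λ p L q t lp s lt → p :* (q :+ (lt :+ lp) :+ (t :- con 1ℚ) :* s) :- p :* (L :+ q :+ lt) := ((t :* p :- p) :* s :- p :* L) :- (:- (p :* lp))) refl
            p (L m) (lg q m) t (lg p m) (σ m) (lg t m))
          (cong (λ z → ((z - p) * σ m - p * L m) - (- (p * lg p m))) tp≡q)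
        where
        t = ratio q p
        0<q = proj₁ (pos 0<p)
        0<t = ratio-pos q p 0<q 0<p
        tp≡q = ratio-* q p 0<p

  marginal : ∀ {n} → (Subset n → ℚ) → Fin n → ℚ
  marginal {n} P k = Σℚ (subsets n) λ S → P S * bit (lookup S k)

  -- Holds for the law `P` of any random subset. Sharp subadditivity would have the binary entropies
  -- of the marginals on the right; their parts (1 - I) log (1/(1 - I)) are replaced here by 2 I.
  entropy-subadditive : ∀ {n} (P : Subset n → ℚ) → (∀ S → 0ℚ ≤ P S) → Σℚ (subsets n) P ≡ 1ℚ →
    (λ m → Σℚ (subsets n) (λ S → - (P S * lg (P S) m))) ≲
    (λ m → (1ℚ + 1ℚ) * Σℚ (allFin n) (marginal P) + Σℚ (allFin n) (λ k → - (marginal P k * lg (marginal P k) m)))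
  entropy-subadditive {n} P 0≤P ΣP≡1 =
    ≲-linear (+-mono-≲ (Σ-mono-≲ Ss terms) (Σ-mono-≲ ks normalisers)) collect
    where
    Ss = subsets n
    ks = allFin n
    I = marginal P

    0≤I : ∀ k → 0ℚ ≤ I k
    0≤I k = Σ-nonNeg Ss λ S → *-nonNeg (0≤P S) (0≤bit (lookup S k))

    0<1+I : ∀ k → 0ℚ < 1ℚ + I k
    0<1+I k = +-pos-nonNeg 0<1ℚ (0≤I k)

    w : Fin n → ℚ
    w k = proj₁ (inverse (1ℚ + I k) (0<1+I k))

    0<w : ∀ k → 0ℚ < w k
    0<w k = proj₁ (proj₂ (inverse (1ℚ + I k) (0<1+I k)))

    w-inverse : ∀ k → w k * (1ℚ + I k) ≡ 1ℚ
    w-inverse k = proj₂ (proj₂ (inverse (1ℚ + I k) (0<1+I k)))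

    Q : Subset n → ℚ
    Q = weight I w

    ratios : List ℚ
    ratios = map (λ S → ratio (Q S) (P S)) Ss

    -- K has to be chosen before any tangent is used, so all arguments are listed now: the ratios
    -- Q(S)/P(S) for Gibbs' inequality and the 1 + I_k for the normalisers.
    open TangentSlope (tangentSlope (ratios ++ map (λ k → 1ℚ + I k) ks))

    0<I : ∀ S → 0ℚ < P S → ∀ k → lookup S k ≡ true → 0ℚ < I k
    0<I S 0<PS k k∈S = <-≤-trans 0<PS (subst (_≤ I k) (trans (cong (λ b → P S * bit b) k∈S) (*-identityʳ (P S)))
      (Σ-≥-term (λ S → *-nonNeg (0≤P S) (0≤bit (lookup S k))) (∈-subsets S)))

    terms : ∀ S → (λ m → - (P S * lg (P S) m)) ≲ (λ m → (Q S - P S) * σ m - P S * lgWeight I w S m)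
    terms S = gibbs-term 0≲σ (0≤P S) (weight-nonNeg I w S (λ k → <⇒≤ (0<w k)) 0≤I)
      (λ 0<PS → weight-pos I w S 0<w (0<I S 0<PS) , lgWeight-≲ I w S 0<w (0<I S 0<PS))
      (All.lookup tangent (∈-++⁺ˡ (∈-map⁺ (λ S → ratio (Q S) (P S)) (∈-subsets S))))

    -- From 1 = w (1 + I) follows - log w ≤ log (1 + I), and log (1 + I) ≤ I σ ≤ 2 I.
    normalisers : ∀ k → (λ m → - lg (w k) m) ≲ (λ _ → (1ℚ + 1ℚ) * I k)
    normalisers k = ≲-linear
      (+-mono-≲ (+-mono-≲ (lg-*-≲ 0<1ℚ (0<w k) (0<1+I k) (≤-reflexive (sym (w-inverse k))))
          (All.lookup tangent (∈-++⁺ʳ ratios (∈-map⁺ (λ k → 1ℚ + I k) (∈-allFin k))) (0<1+I k)))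
        (*-mono-≲ (0≤I k) σ≲2))
      λ m → trans (cong (λ z → (lg (w k) m + lg (1ℚ + I k) m + (1ℚ + I k - 1ℚ) * σ m + I k * (1ℚ + 1ℚ)) - (z + lg (1ℚ + I k) m + I k * σ m)) (lg-1 m))
        (solve 4 (λ w l I s → (w :+ l :+ (con 1ℚ :+ I :- con 1ℚ) :* s :+ I :* con (1ℚ + 1ℚ)) :- (con 0ℚ :+ l :+ I :* s) := con (1ℚ + 1ℚ) :* I :- (:- w)) refl
          (lg (w k) m) (lg (1ℚ + I k) m) (I k) (σ m))

    -- After exchanging the sums, `lg (w k)` is weighted by the total mass 1 and `lg (I k)` by the
    -- marginal I k.
    ΣPL : ∀ m → Σℚ Ss (λ S → P S * lgWeight I w S m) ≡ Σℚ ks (λ k → lg (w k) m) + Σℚ ks (λ k → I k * lg (I k) m)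
    ΣPL m = begin
      Σℚ Ss (λ S → P S * lgWeight I w S m)
        ≡⟨ Σ-cong Ss (λ S → sym (Σ-*ˡ ks (P S) (λ k → lg (w k) m + bit (lookup S k) * lg (I k) m))) ⟩
      Σℚ Ss (λ S → Σℚ ks λ k → P S * (lg (w k) m + bit (lookup S k) * lg (I k) m))
        ≡⟨ Σ-swap Ss ks (λ S k → P S * (lg (w k) m + bit (lookup S k) * lg (I k) m)) ⟩
      Σℚ ks (λ k → Σℚ Ss λ S → P S * (lg (w k) m + bit (lookup S k) * lg (I k) m))
        ≡⟨ Σ-cong ks (λ k → trans
             (Σ-cong Ss (λ S → solve 4 (λ p b w l → p :* (w :+ b :* l) := p :* w :+ p :* b :* l) refl (P S) (bit (lookup S k)) (lg (w k) m) (lg (I k) m)))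
             (trans (Σ-+ Ss (λ S → P S * lg (w k) m) (λ S → P S * bit (lookup S k) * lg (I k) m))
               (cong₂ _+_
                 (trans (Σ-*ʳ Ss (lg (w k) m) P) (trans (cong (_* lg (w k) m) ΣP≡1) (*-identityˡ (lg (w k) m))))
                 (Σ-*ʳ Ss (lg (I k) m) (λ S → P S * bit (lookup S k)))))) ⟩
      Σℚ ks (λ k → lg (w k) m + I k * lg (I k) m)
        ≡⟨ Σ-+ ks (λ k → lg (w k) m) (λ k → I k * lg (I k) m) ⟩
      Σℚ ks (λ k → lg (w k) m) + Σℚ ks (λ k → I k * lg (I k) m) ∎
      where open ≡-Reasoning

    collect : ∀ m →
      (Σℚ Ss (λ S → (Q S - P S) * σ m - P S * lgWeight I w S m) + Σℚ ks (λ k → (1ℚ + 1ℚ) * I k)) -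
        (Σℚ Ss (λ S → - (P S * lg (P S) m)) + Σℚ ks (λ k → - lg (w k) m)) ≡
      ((1ℚ + 1ℚ) * Σℚ ks I + Σℚ ks (λ k → - (I k * lg (I k) m))) - Σℚ Ss (λ S → - (P S * lg (P S) m))
    collect m = begin
      (Σℚ Ss (λ S → (Q S - P S) * σ m - P S * lgWeight I w S m) + Σℚ ks (λ k → (1ℚ + 1ℚ) * I k)) - (H + Σℚ ks (λ k → - lg (w k) m))
        ≡⟨ cong₂ _-_ (cong₂ _+_ cross (Σ-*ˡ ks (1ℚ + 1ℚ) I)) (cong (λ z → H + z) (Σ-neg ks (λ k → lg (w k) m))) ⟩
      -- Here 1 - 1 is ∑ Q - ∑ P, which removes σ; the sum `W` of the log w k occurs on both sides
      -- and cancels.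
      ((1ℚ - 1ℚ) * σ m - (W + J) + (1ℚ + 1ℚ) * Σℚ ks I) - (H + - W)
        ≡⟨ solve 5 (λ s W J T H → ((con 1ℚ :- con 1ℚ) :* s :- (W :+ J) :+ T) :- (H :+ :- W) := (T :+ :- J) :- H) refl (σ m) W J ((1ℚ + 1ℚ) * Σℚ ks I) H ⟩
      ((1ℚ + 1ℚ) * Σℚ ks I + - J) - H
        ≡⟨ cong (λ z → ((1ℚ + 1ℚ) * Σℚ ks I + z) - H) (sym (Σ-neg ks (λ k → I k * lg (I k) m))) ⟩
      ((1ℚ + 1ℚ) * Σℚ ks I + Σℚ ks (λ k → - (I k * lg (I k) m))) - H ∎
      where
      open ≡-Reasoning
      H = Σℚ Ss (λ S → - (P S * lg (P S) m))
      W = Σℚ ks (λ k → lg (w k) m)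
      J = Σℚ ks (λ k → I k * lg (I k) m)
      cross : Σℚ Ss (λ S → (Q S - P S) * σ m - P S * lgWeight I w S m) ≡ (1ℚ - 1ℚ) * σ m - (W + J)
      cross = trans (Σ-- Ss (λ S → (Q S - P S) * σ m) (λ S → P S * lgWeight I w S m))
        (cong₂ _-_
          (trans (Σ-*ʳ Ss (σ m) (λ S → Q S - P S)) (cong (_* σ m) (trans (Σ-- Ss Q P) (cong₂ _-_ (Σ-weight I w w-inverse) ΣP≡1))))
          (ΣPL m))

  -- Fourier–Walsh analysis

  res⁻ res⁺ : ∀ {n} → (Cube (suc n) → ℚ) → Cube n → ℚ
  res⁻ g x = g (Sign.- ∷ x)
  res⁺ g x = g (Sign.+ ∷ x)

  N⁻¹ : ℕ → ℚ
  N⁻¹ n = recip (2 ℕ.^ n) {{ℕₚ.m^n≢0 2 n}}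

  N⁻¹-suc : ∀ n → N⁻¹ (suc n) ≡ ½ * N⁻¹ n
  N⁻¹-suc n = begin
    a                          ≡⟨ solve 1 (λ a → a := a :* con 1ℚ) refl a ⟩
    a * 1ℚ                     ≡⟨ cong (a *_) (sym (ι*recip N {{N≢0}})) ⟩
    a * (ι N * b)              ≡⟨ solve 3 (λ a x b → a :* (x :* b) := con ½ :* (((con 1ℚ :+ con 1ℚ) :* x) :* a) :* b) refl a (ι N) b ⟩
    ½ * ((1ℚ + 1ℚ) * ι N * a) * b   ≡⟨ cong (λ z → ½ * (z * a) * b) (sym ι-2N) ⟩
    ½ * (ι (2 ℕ.* N) * a) * b  ≡⟨ cong (λ z → ½ * z * b) (ι*recip (2 ℕ.* N) {{ℕₚ.m^n≢0 2 (suc n)}}) ⟩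
    ½ * 1ℚ * b                 ≡⟨⟩
    ½ * b                      ∎
    where
    open ≡-Reasoning
    N = 2 ℕ.^ n
    N≢0 = ℕₚ.m^n≢0 2 n
    a = N⁻¹ (suc n)
    b = N⁻¹ n
    ι-2N : ι (2 ℕ.* N) ≡ (1ℚ + 1ℚ) * ι N
    ι-2N = trans (ι-* 2 N) (cong (_* ι N) (trans (ι-suc 1) (cong (λ z → 1ℚ + z) ι-1)))

  𝔼-def : ∀ {n} (g : Cube n → ℚ) → 𝔼 g ≡ Σℚ (cube n) g * N⁻¹ n
  𝔼-def {n} g = cong (Σℚ (cube n) g *_) (recip-def (2 ℕ.^ n) {{ℕₚ.m^n≢0 2 n}})

  𝔼-cong : ∀ {n} {g h : Cube n → ℚ} → (∀ x → g x ≡ h x) → 𝔼 g ≡ 𝔼 h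
  𝔼-cong {n} {g} {h} eq = trans (𝔼-def g) (trans (cong (_* N⁻¹ n) (Σ-cong (cube n) eq)) (sym (𝔼-def h)))

  𝔼-*ˡ : ∀ {n} c (g : Cube n → ℚ) → 𝔼 (λ x → c * g x) ≡ c * 𝔼 g
  𝔼-*ˡ {n} c g = trans (𝔼-def (λ x → c * g x)) (trans (cong (_* N⁻¹ n) (Σ-*ˡ (cube n) c g))
    (trans (*-assoc c (Σℚ (cube n) g) (N⁻¹ n)) (cong (c *_) (sym (𝔼-def g)))))

  𝔼-- : ∀ {n} (g h : Cube n → ℚ) → 𝔼 (λ x → g x - h x) ≡ 𝔼 g - 𝔼 h
  𝔼-- {n} g h = trans (𝔼-def (λ x → g x - h x)) (trans (cong (_* N⁻¹ n) (Σ-- (cube n) g h))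
    (trans (solve 3 (λ a b c → (a :- b) :* c := a :* c :- b :* c) refl (Σℚ (cube n) g) (Σℚ (cube n) h) (N⁻¹ n))
      (cong₂ _-_ (sym (𝔼-def g)) (sym (𝔼-def h)))))

  𝔼-suc : ∀ {n} (g : Cube (suc n) → ℚ) → 𝔼 g ≡ ½ * (𝔼 (res⁺ g) + 𝔼 (res⁻ g))
  𝔼-suc {n} g = begin
    𝔼 g                                      ≡⟨ 𝔼-def g ⟩
    Σℚ (cube (suc n)) g * N⁻¹ (suc n)        ≡⟨ cong₂ _*_ (Σ-allVec n Sign.- Sign.+ g) (N⁻¹-suc n) ⟩
    (G⁻ + G⁺) * (½ * N⁻¹ n)                  ≡⟨ solve 3 (λ a b c → (a :+ b) :* (con ½ :* c) := con ½ :* (b :* c :+ a :* c)) refl G⁻ G⁺ (N⁻¹ n) ⟩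
    ½ * (G⁺ * N⁻¹ n + G⁻ * N⁻¹ n)            ≡⟨ cong (½ *_) (cong₂ _+_ (sym (𝔼-def (res⁺ g))) (sym (𝔼-def (res⁻ g)))) ⟩
    ½ * (𝔼 (res⁺ g) + 𝔼 (res⁻ g))                ∎
    where
    open ≡-Reasoning
    G⁻ = Σℚ (cube n) (res⁻ g)
    G⁺ = Σℚ (cube n) (res⁺ g)

  𝔼-1 : ∀ n → 𝔼 {n} (λ _ → 1ℚ) ≡ 1ℚ
  𝔼-1 zero    = refl
  𝔼-1 (suc n) = trans (𝔼-suc {n} (λ _ → 1ℚ)) (cong (λ z → ½ * (z + z)) (𝔼-1 n))

  -- General in `h` because the tail of `tabulate h` is `tabulate (h ∘ suc)`: for the identity alone
  -- the induction would not close.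
  filter-tabulate-suc : ∀ {n m} (b : Bool) (S : Subset n) (h : Fin m → Fin n) →
    filter (_∈? (b ∷ S)) (tabulate (suc ∘ h)) ≡ map suc (filter (_∈? S) (tabulate h))
  filter-tabulate-suc {m = zero}  b S h = refl
  filter-tabulate-suc {m = suc m} b S h with does (h zero ∈? S)
  ... | true  = cong (suc (h zero) ∷_) (filter-tabulate-suc b S (h ∘ suc))
  ... | false = filter-tabulate-suc b S (h ∘ suc)

  X-suc : ∀ {n} (S : Subset n) b s (x : Cube n) →
    foldr _*_ 1ℚ (map (λ k → ⟦ lookup (s ∷ x) k ⟧) (filter (_∈? (b ∷ S)) (tabulate suc))) ≡ X S x
  X-suc {n} S b s x = cong (foldr _*_ 1ℚ) (trans
    (cong (map (λ k → ⟦ lookup (s ∷ x) k ⟧)) (filter-tabulate-suc b S id))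
    (sym (Listₚ.map-∘ (filter (_∈? S) (allFin n)))))

  X-false : ∀ {n} (S : Subset n) s (x : Cube n) → X (false ∷ S) (s ∷ x) ≡ X S x
  X-false S = X-suc S false

  X-true : ∀ {n} (S : Subset n) s (x : Cube n) → X (true ∷ S) (s ∷ x) ≡ ⟦ s ⟧ * X S x
  X-true S s x = cong (⟦ s ⟧ *_) (X-suc S true s x)

  coeff : ∀ {n} → (Cube n → ℚ) → Subset n → ℚ
  coeff g S = 𝔼 (λ x → g x * X S x)

  coeff-false : ∀ {n} (g : Cube (suc n) → ℚ) S → coeff g (false ∷ S) ≡ ½ * (coeff (res⁺ g) S + coeff (res⁻ g) S)
  coeff-false g S = trans (𝔼-suc (λ x → g x * X (false ∷ S) x)) (cong (½ *_) (cong₂ _+_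
    (𝔼-cong λ x → cong (res⁺ g x *_) (X-false S Sign.+ x))
    (𝔼-cong λ x → cong (res⁻ g x *_) (X-false S Sign.- x))))

  coeff-true : ∀ {n} (g : Cube (suc n) → ℚ) S → coeff g (true ∷ S) ≡ ½ * (coeff (res⁺ g) S - coeff (res⁻ g) S)
  coeff-true g S = trans (𝔼-suc (λ x → g x * X (true ∷ S) x)) (cong (½ *_) (cong₂ _+_
    (𝔼-cong λ x → cong (res⁺ g x *_) (trans (X-true S Sign.+ x) (*-identityˡ (X S x))))
    (trans (𝔼-cong λ x → trans (cong (res⁻ g x *_) (X-true S Sign.- x))
        (solve 2 (λ a b → a :* (con (- 1ℚ) :* b) := con (- 1ℚ) :* (a :* b)) refl (res⁻ g x) (X S x)))
      (trans (𝔼-*ˡ (- 1ℚ) (λ x → res⁻ g x * X S x))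
        (solve 1 (λ a → con (- 1ℚ) :* a := :- a) refl (coeff (res⁻ g) S))))))

  coeff-½- : ∀ {n} (g h : Cube n → ℚ) S → coeff (λ x → ½ * (g x - h x)) S ≡ ½ * (coeff g S - coeff h S)
  coeff-½- g h S = trans
    (𝔼-cong λ x → solve 3 (λ g h X → con ½ :* (g :- h) :* X := con ½ :* (g :* X :- h :* X)) refl (g x) (h x) (X S x))
    (trans (𝔼-*ˡ ½ (λ x → g x * X S x - h x * X S x)) (cong (½ *_) (𝔼-- (λ x → g x * X S x) (λ x → h x * X S x))))

  spectrum : ∀ {n} → (Cube n → ℚ) → Subset n → ℚ
  spectrum g S = coeff g S * coeff g S

  -- The two coefficients of g at S and S ∪ {0} are the half-sum and half-difference of those of res⁺ g and res⁻ g.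
  parallelogram : ∀ {n} (g : Cube (suc n) → ℚ) S →
    spectrum g (false ∷ S) + spectrum g (true ∷ S) ≡ ½ * (spectrum (res⁺ g) S + spectrum (res⁻ g) S)
  parallelogram g S = trans
    (cong₂ _+_ (cong₂ _*_ (coeff-false g S) (coeff-false g S)) (cong₂ _*_ (coeff-true g S) (coeff-true g S)))
    (solve 2 (λ a b → (con ½ :* (a :+ b)) :* (con ½ :* (a :+ b)) :+ (con ½ :* (a :- b)) :* (con ½ :* (a :- b)) := con ½ :* (a :* a :+ b :* b)) refl
      (coeff (res⁺ g) S) (coeff (res⁻ g) S))

  -- The weight `c` does not see coordinate 0, so the parallelogram identity can be applied under
  -- the sum. With c = 1 this is the induction step of Parseval, with c the indicator of k ∈ S that
  -- of the marginals.
  Σ-spectrum-suc : ∀ {n} (g : Cube (suc n) → ℚ) (c : Subset n → ℚ) →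
    Σℚ (subsets n) (λ S → spectrum g (false ∷ S) * c S) + Σℚ (subsets n) (λ S → spectrum g (true ∷ S) * c S) ≡
    ½ * (Σℚ (subsets n) (λ S → spectrum (res⁺ g) S * c S) + Σℚ (subsets n) (λ S → spectrum (res⁻ g) S * c S))
  Σ-spectrum-suc {n} g c = begin
    Σℚ Ss (λ S → spectrum g (false ∷ S) * c S) + Σℚ Ss (λ S → spectrum g (true ∷ S) * c S)
      ≡⟨ Σ-+ Ss (λ S → spectrum g (false ∷ S) * c S) (λ S → spectrum g (true ∷ S) * c S) ⟨
    Σℚ Ss (λ S → spectrum g (false ∷ S) * c S + spectrum g (true ∷ S) * c S)
      ≡⟨ Σ-cong Ss (λ S → trans (sym (*-distribʳ-+ (c S) (spectrum g (false ∷ S)) (spectrum g (true ∷ S))))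
           (trans (cong (_* c S) (parallelogram g S))
             (solve 3 (λ a b c → con ½ :* (a :+ b) :* c := con ½ :* (a :* c :+ b :* c)) refl (spectrum (res⁺ g) S) (spectrum (res⁻ g) S) (c S)))) ⟩
    Σℚ Ss (λ S → ½ * (spectrum (res⁺ g) S * c S + spectrum (res⁻ g) S * c S))
      ≡⟨ Σ-*ˡ Ss ½ (λ S → spectrum (res⁺ g) S * c S + spectrum (res⁻ g) S * c S) ⟩
    ½ * Σℚ Ss (λ S → spectrum (res⁺ g) S * c S + spectrum (res⁻ g) S * c S)
      ≡⟨ cong (½ *_) (Σ-+ Ss (λ S → spectrum (res⁺ g) S * c S) (λ S → spectrum (res⁻ g) S * c S)) ⟩
    ½ * (Σℚ Ss (λ S → spectrum (res⁺ g) S * c S) + Σℚ Ss (λ S → spectrum (res⁻ g) S * c S)) ∎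
    where
    open ≡-Reasoning
    Ss = subsets n

  parseval : ∀ {n} (g : Cube n → ℚ) → Σℚ (subsets n) (spectrum g) ≡ 𝔼 (λ x → g x * g x)
  parseval {zero} g = solve 1 (λ a → (((a :* con 1ℚ :+ con 0ℚ) :* con 1ℚ) :* ((a :* con 1ℚ :+ con 0ℚ) :* con 1ℚ)) :+ con 0ℚ := (a :* a :+ con 0ℚ) :* con 1ℚ) refl (g [])
  parseval {suc n} g = begin
    Σℚ (subsets (suc n)) (spectrum g)
      ≡⟨ Σ-allVec n false true (spectrum g) ⟩
    Σℚ (subsets n) (λ S → spectrum g (false ∷ S)) + Σℚ (subsets n) (λ S → spectrum g (true ∷ S))
      ≡⟨ cong₂ _+_ (Σ-cong (subsets n) λ S → sym (*-identityʳ _)) (Σ-cong (subsets n) λ S → sym (*-identityʳ _)) ⟩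
    Σℚ (subsets n) (λ S → spectrum g (false ∷ S) * 1ℚ) + Σℚ (subsets n) (λ S → spectrum g (true ∷ S) * 1ℚ)
      ≡⟨ Σ-spectrum-suc g (λ _ → 1ℚ) ⟩
    ½ * (Σℚ (subsets n) (λ S → spectrum (res⁺ g) S * 1ℚ) + Σℚ (subsets n) (λ S → spectrum (res⁻ g) S * 1ℚ))
      ≡⟨ cong (½ *_) (cong₂ _+_
           (trans (Σ-cong (subsets n) λ S → *-identityʳ _) (parseval (res⁺ g)))
           (trans (Σ-cong (subsets n) λ S → *-identityʳ _) (parseval (res⁻ g)))) ⟩
    ½ * (𝔼 (λ x → res⁺ g x * res⁺ g x) + 𝔼 (λ x → res⁻ g x * res⁻ g x))
      ≡⟨ 𝔼-suc (λ x → g x * g x) ⟨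
    𝔼 (λ x → g x * g x) ∎
    where open ≡-Reasoning

  -- The part of the Walsh expansion of g carried by the sets containing k.
  ∂ : ∀ {n} → Fin n → (Cube n → ℚ) → Cube n → ℚ
  ∂ k g x = ½ * (g x - g (μ k x))

  -- Induction on the position of k. For coordinate 0 the coefficients of g at S ∪ {0} are those of
  -- the half-difference of the two restrictions, to which Parseval applies; for a later coordinate
  -- both sides average over the restrictions.
  marginal-spectrum : ∀ {n} (k : Fin n) (g : Cube n → ℚ) → marginal (spectrum g) k ≡ 𝔼 (λ x → ∂ k g x * ∂ k g x)
  marginal-spectrum {suc n} zero g = begin
    marginal (spectrum g) zero
      ≡⟨ Σ-allVec n false true (λ S → spectrum g S * bit (lookup S zero)) ⟩
    Σℚ Ss (λ S → spectrum g (false ∷ S) * 0ℚ) + Σℚ Ss (λ S → spectrum g (true ∷ S) * 1ℚ)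
      ≡⟨ cong₂ _+_ (trans (Σ-cong Ss λ S → *-zeroʳ (spectrum g (false ∷ S))) (Σ-0 Ss))
           (Σ-cong Ss λ S → trans (*-identityʳ _) (cong₂ _*_ (coeff≡ S) (coeff≡ S))) ⟩
    0ℚ + Σℚ Ss (spectrum h)
      ≡⟨ trans (+-identityˡ _) (parseval h) ⟩
    E
      ≡⟨ solve 1 (λ a → a := con ½ :* (a :+ a)) refl E ⟩
    ½ * (E + E)
      -- On the other half of the cube the difference changes sign, but its square does not.
      ≡⟨ cong (λ z → ½ * (E + z)) (𝔼-cong λ x → solve 2 (λ a b → (con ½ :* (a :- b)) :* (con ½ :* (a :- b)) := (con ½ :* (b :- a)) :* (con ½ :* (b :- a))) refl (res⁺ g x) (res⁻ g x)) ⟩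
    ½ * (E + 𝔼 (λ x → (½ * (res⁻ g x - res⁺ g x)) * (½ * (res⁻ g x - res⁺ g x))))
      ≡⟨ 𝔼-suc (λ x → ∂ zero g x * ∂ zero g x) ⟨
    𝔼 (λ x → ∂ zero g x * ∂ zero g x) ∎
    where
    open ≡-Reasoning
    Ss = subsets n
    h : Cube n → ℚ
    h x = ½ * (res⁺ g x - res⁻ g x)
    E = 𝔼 (λ x → h x * h x)
    coeff≡ : ∀ S → coeff g (true ∷ S) ≡ coeff h S
    coeff≡ S = trans (coeff-true g S) (sym (coeff-½- (res⁺ g) (res⁻ g) S))
  marginal-spectrum {suc n} (suc k) g = begin
    marginal (spectrum g) (suc k)
      ≡⟨ Σ-allVec n false true (λ S → spectrum g S * bit (lookup S (suc k))) ⟩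
    Σℚ (subsets n) (λ S → spectrum g (false ∷ S) * bit (lookup S k)) + Σℚ (subsets n) (λ S → spectrum g (true ∷ S) * bit (lookup S k))
      ≡⟨ Σ-spectrum-suc g (λ S → bit (lookup S k)) ⟩
    ½ * (marginal (spectrum (res⁺ g)) k + marginal (spectrum (res⁻ g)) k)
      ≡⟨ cong (½ *_) (cong₂ _+_ (marginal-spectrum k (res⁺ g)) (marginal-spectrum k (res⁻ g))) ⟩
    ½ * (𝔼 (λ x → ∂ k (res⁺ g) x * ∂ k (res⁺ g) x) + 𝔼 (λ x → ∂ k (res⁻ g) x * ∂ k (res⁻ g) x))
      ≡⟨ 𝔼-suc (λ x → ∂ (suc k) g x * ∂ (suc k) g x) ⟨
    𝔼 (λ x → ∂ (suc k) g x * ∂ (suc k) g x) ∎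
    where open ≡-Reasoning

  -- Influences as marginals of the spectral measure

  ℙ-def : ∀ {n p} {P : Pred (Cube n) p} (P? : Decidable P) → ℙ P? ≡ ι (length (filter P? (cube n))) * N⁻¹ n
  ℙ-def {n} P? = trans (+/≡ι* k (2 ℕ.^ n) {{ℕₚ.m^n≢0 2 n}}) (cong (ι k *_) (recip-def (2 ℕ.^ n) {{ℕₚ.m^n≢0 2 n}}))
    where k = length (filter P? (cube n))

  ℙ≡𝔼 : ∀ {n p} {P : Pred (Cube n) p} (P? : Decidable P) → ℙ P? ≡ 𝔼 (λ x → bit (does (P? x)))
  ℙ≡𝔼 {n} P? = trans (ℙ-def P?) (trans (cong (_* N⁻¹ n) (count (cube n))) (sym (𝔼-def (λ x → bit (does (P? x))))))
    where
    count : ∀ xs → ι (length (filter P? xs)) ≡ Σℚ xs (λ x → bit (does (P? x)))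
    count []       = ι-0
    count (x ∷ xs) with does (P? x)
    ... | true  = trans (ι-suc (length (filter P? xs))) (cong (λ z → 1ℚ + z) (count xs))
    ... | false = trans (count xs) (sym (+-identityˡ _))

  module _ {n} (f : BooleanFunction n) where

    spectralMeasure : Subset n → ℚ
    spectralMeasure = spectrum (λ x → ⟦ f x ⟧)

    Σ-spectralMeasure : Σℚ (subsets n) spectralMeasure ≡ 1ℚ
    Σ-spectralMeasure = trans (parseval (λ x → ⟦ f x ⟧)) (trans (𝔼-cong λ x → ⟦⟧² (f x)) (𝔼-1 n))
      where
      ⟦⟧² : ∀ s → ⟦ s ⟧ * ⟦ s ⟧ ≡ 1ℚ
      ⟦⟧² Sign.- = refl
      ⟦⟧² Sign.+ = refl

    -- For values ±1 the squared half-difference is the indicator of s ≠ t.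
    marginal-spectralMeasure : ∀ k → marginal spectralMeasure k ≡ Inf k f
    marginal-spectralMeasure k = trans (marginal-spectrum k (λ x → ⟦ f x ⟧))
      (trans (𝔼-cong λ x → D² (f x) (f (μ k x))) (sym (ℙ≡𝔼 (λ x → ¬? (f x Signₚ.≟ f (μ k x))))))
      where
      D² : ∀ s t → (½ * (⟦ s ⟧ - ⟦ t ⟧)) * (½ * (⟦ s ⟧ - ⟦ t ⟧)) ≡ bit (does (¬? (s Signₚ.≟ t)))
      D² Sign.- Sign.- = refl
      D² Sign.- Sign.+ = refl
      D² Sign.+ Sign.- = refl
      D² Sign.+ Sign.+ = refl

  -- Positive total influence of non-constant functions

  ∈-cube : ∀ {n} (x : Cube n) → x ∈ cube n
  ∈-cube = ∈-allVec λ { Sign.- → here refl ; Sign.+ → there (here refl) }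

  -- Any two points of the cube are joined by flipping coordinates one at a time: the tail is
  -- changed recursively, then the head if necessary.
  invariant⇒constant : ∀ {n} (f : BooleanFunction n) → (∀ k x → f x ≡ f (μ k x)) → ∀ x y → f x ≡ f y
  invariant⇒constant f inv [] [] = refl
  invariant⇒constant f inv (s ∷ x) (t ∷ y) = trans (invariant⇒constant (f ∘ (s ∷_)) (λ k x → inv (suc k) (s ∷ x)) x y) (head s t)
    where
    head : ∀ s t → f (s ∷ y) ≡ f (t ∷ y)
    head Sign.- Sign.- = refl
    head Sign.- Sign.+ = inv zero (Sign.- ∷ y)
    head Sign.+ Sign.- = inv zero (Sign.+ ∷ y)
    head Sign.+ Sign.+ = refl

  sensitive? : ∀ {n} k (f : BooleanFunction n) → Decidable (λ x → f x ≢ f (μ k x))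
  sensitive? k f x = ¬? (f x Signₚ.≟ f (μ k x))

  0<N⁻¹ : ∀ n → 0ℚ < N⁻¹ n
  0<N⁻¹ n = 0<recip (2 ℕ.^ n) {{ℕₚ.m^n≢0 2 n}}

  0≤Inf : ∀ {n} k (f : BooleanFunction n) → 0ℚ ≤ Inf k f
  0≤Inf {n} k f = subst (0ℚ ≤_) (sym (ℙ-def (sensitive? k f))) (*-nonNeg (0≤ι _) (<⇒≤ (0<N⁻¹ n)))

  0<Inf : ∀ {n} k (f : BooleanFunction n) x → f x ≢ f (μ k x) → 0ℚ < Inf k f
  0<Inf {n} k f x fx≢ = subst (0ℚ <_) (sym (ℙ-def (sensitive? k f)))
    (*-pos (0<ι _ {{ℕ.>-nonZero (Listₚ.filter-some (sensitive? k f) (lose (∈-cube x) fx≢))}}) (0<N⁻¹ n))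

  0≤totalInf : ∀ {n} (f : BooleanFunction n) → 0ℚ ≤ totalInf f
  0≤totalInf {n} f = Σ-nonNeg (allFin n) λ k → 0≤Inf k f

  nonConstant⇒0<totalInf : ∀ {n} (f : BooleanFunction n) → NonConstant f → 0ℚ < totalInf f
  nonConstant⇒0<totalInf f (x , y , fx≢fy) with 0ℚ <? totalInf f
  ... | yes 0<I = 0<I
  ... | no  ≮   = ⊥-elim (fx≢fy (invariant⇒constant f invariant x y))
    where
    invariant : ∀ k x → f x ≡ f (μ k x)
    invariant k x with f x Signₚ.≟ f (μ k x)
    ... | yes eq = eq
    ... | no neq = ⊥-elim (≮ (<-≤-trans (0<Inf k f x neq) (Σ-≥-term (λ k → 0≤Inf k f) (∈-allFin k))))

  -- Passage to the reals

  seq-∑ : ∀ {A : Set} (xs : List A) (g : A → ℝ) m → seq (∑ xs g) m ≡ Σℚ xs (λ x → seq (g x) m)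
  seq-∑ []       g m = refl
  seq-∑ (x ∷ xs) g m = cong (λ z → seq (g x) m + z) (seq-∑ xs g m)

  -- Inverting p > 0 swaps numerator and denominator, so the approximations of log₂ (1/p) are
  -- exactly the negatives of those of log₂ p, without any error term. At p = 0 both sides are 0.
  seq-plog1/p : ∀ p → 0ℚ ≤ p → ∀ m → seq (plog1/p p) m ≡ - (p * lg p m)
  seq-plog1/p p 0≤p m with 0ℚ <? p
  ... | no ≮ = sym (cong (λ p → - (p * lg p m)) (nonNeg∧≮⇒0 0≤p ≮))
  ... | yes 0<p = positive p {{ℚ.positive 0<p}}
    where
    positive : ∀ p {{p>0 : Positive p}} → p * seq (log₂ ((ℚ.1/ p) {{pos⇒nonZero p}}) {{1/pos⇒pos p}}) m ≡ - (p * lg p m)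
    positive p@(mkℚ +[1+ n ] d _) = solve 3 (λ p a b → p :* (b :- a) := :- (p :* (a :- b))) refl p (log₂ℕ-approx (suc n) m) (log₂ℕ-approx (suc d) m)

  natural-bound : ∀ C → ∃ λ c → C ≤ ι c
  natural-bound C@(mkℚ (+ n) d c) = n , subst₂ _≤_ (*-identityʳ C) (ι-num-den n d c)
    (*-monoˡ-≤-nonNeg C (subst (_≤ ι (suc d)) ι-1 (ι-mono (ℕ.s≤s ℕ.z≤n))))
  natural-bound C@(mkℚ -[1+ n ] d c) = 0 , subst (C ≤_) (sym ι-0) (<⇒≤ (negative⁻¹ C))

  C*e-vanishes : ∀ C ε → 0ℚ < ε → ∃ λ N → ∀ m → N ℕ.≤ m → C * e m ≤ ε
  C*e-vanishes C ε 0<ε =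
    let c , C≤c = natural-bound C
        j , εd≡j = denominator-clears ε 0<ε
        d = ℚ.↧ₙ ε
    -- With d the denominator of ε, positivity gives ε d ≥ 1. As C ≤ c, every m ≥ d c satisfies C ≤
    -- c ≤ ε d c ≤ ε (m + 1).
    in d ℕ.* c , λ m N≤m →
      let open ≤-Reasoning
          instance
            e≥0 : ℚ.NonNegative (e m)
            e≥0 = ℚ.nonNegative (<⇒≤ (0<recip (suc m)))
            c≥0 : ℚ.NonNegative (ι c)
            c≥0 = ℚ.nonNegative (0≤ι c)
            ε≥0 : ℚ.NonNegative ε
            ε≥0 = ℚ.nonNegative (<⇒≤ 0<ε)
      in begin
        C * e m                       ≤⟨ *-monoʳ-≤-nonNeg (e m) C≤c ⟩
        ι c * e m                     ≡⟨ cong (_* e m) (sym (*-identityˡ (ι c))) ⟩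
        1ℚ * ι c * e m                ≤⟨ *-monoʳ-≤-nonNeg (e m) (*-monoʳ-≤-nonNeg (ι c) (1≤ι j (subst (0ℚ <_) εd≡j (*-pos 0<ε (0<ι d))))) ⟩
        ι j * ι c * e m               ≡⟨ cong (λ z → z * ι c * e m) (sym εd≡j) ⟩
        ε * ι d * ι c * e m           ≡⟨ cong (_* e m) (trans (*-assoc ε (ι d) (ι c)) (cong (ε *_) (sym (ι-* d c)))) ⟩
        ε * ι (d ℕ.* c) * e m         ≤⟨ *-monoʳ-≤-nonNeg (e m) (*-monoˡ-≤-nonNeg ε (ι-mono (ℕₚ.m≤n⇒m≤1+n N≤m))) ⟩
        ε * ι (suc m) * e m           ≡⟨ trans (*-assoc ε (ι (suc m)) (e m)) (trans (cong (ε *_) (ι*recip (suc m))) (*-identityʳ ε)) ⟩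
        ε                             ∎
    where
    1≤ι : ∀ j → 0ℚ < ι j → 1ℚ ≤ ι j
    1≤ι zero    0<0 = ⊥-elim (<-irrefl (sym ι-0) 0<0)
    1≤ι (suc j) _   = subst (_≤ ι (suc j)) ι-1 (ι-mono (ℕ.s≤s ℕ.z≤n))

  ≲⇒≤ : ∀ x y → seq x ≲ seq y → x Defs.≤ y
  ≲⇒≤ x y (mk≲ C h) ε 0<ε =
    let N , small = C*e-vanishes C ε 0<ε
    in N , λ m N≤m → ≤-trans (h m) (+-monoʳ-≤ (seq y m) (small m N≤m))

  ≲⇒< : ∀ x y {c} → 0ℚ < c → (λ m → seq x m + c) ≲ seq y → x Defs.< y
  ≲⇒< x y {c} 0<c (mk≲ C h) =
    -- Half of the gap `c` absorbs the error term; the other half witnesses strictness.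
    let 0<½c = *-pos (positive⁻¹ ½) 0<c
        N , small = C*e-vanishes C (½ * c) 0<½c
    in ½ * c , 0<½c , N , λ m N≤m →
      linear (≤-trans (h m) (+-monoʳ-≤ (seq y m) (small m N≤m)))
        (solve 3 (λ x y c → y :+ con ½ :* c :- (x :+ c) := y :- (x :+ con ½ :* c)) refl (seq x m) (seq y m) c)

  0<fromℚ : ∀ {q} → 0ℚ < q → fromℚ 0ℚ Defs.< fromℚ q
  0<fromℚ {q} 0<q = q , 0<q , 0 , λ _ _ → ≤-reflexive (+-identityˡ q)

  2ℚ 3ℚ : ℚ
  2ℚ = 1ℚ + 1ℚ
  3ℚ = 1ℚ + 2ℚ

  module _ {n} (f : BooleanFunction n) where

    influenceBound : ℝ
    influenceBound = fromℚ 3ℚ Defs.* fromℚ (totalInf f) Defs.+ fromℚ 1ℚ Defs.* ∑ (allFin n) (λ k → plog1/p (Inf k f))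

    seq-Ent : ∀ m → seq (Ent f) m ≡ Σℚ (subsets n) (λ S → - (spectralMeasure f S * lg (spectralMeasure f S) m))
    seq-Ent m = trans (seq-∑ (subsets n) (λ S → plog1/p (fourier f S * fourier f S)) m)
      (Σ-cong (subsets n) λ S → seq-plog1/p (spectralMeasure f S) (0≤p² (fourier f S)) m)

    -- Two of the three copies of I(f) in the bound pay for the normalisers. The third is kept on
    -- the left as the gap: it is dropped for the weak inequality and is positive for non-constant
    -- f.
    Ent-≲ : (λ m → seq (Ent f) m + totalInf f) ≲ seq influenceBound
    Ent-≲ = ≲-linear (entropy-subadditive (spectralMeasure f) (λ S → 0≤p² (fourier f S)) (Σ-spectralMeasure f)) λ m →
      trans (cong₂ (λ a b → 2ℚ * a + b - Σℚ (subsets n) (λ S → - (spectralMeasure f S * lg (spectralMeasure f S) m)))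
          (Σ-cong (allFin n) (marginal-spectralMeasure f))
          (trans (Σ-cong (allFin n) λ k → trans (cong (λ p → - (p * lg p m)) (marginal-spectralMeasure f k)) (sym (seq-plog1/p (Inf k f) (0≤Inf k f) m)))
            (sym (seq-∑ (allFin n) (λ k → plog1/p (Inf k f)) m))))
      (trans (cong (λ z → 2ℚ * I + J m - z) (sym (seq-Ent m)))
        (solve 3 (λ I J E → con 2ℚ :* I :+ J :- E := con 3ℚ :* I :+ con 1ℚ :* J :- (E :+ I)) refl I (J m) (seq (Ent f) m)))
      where
      I = totalInf f
      J = seq (∑ (allFin n) (λ k → plog1/p (Inf k f)))

    Ent-≤ : Ent f Defs.≤ influenceBound
    Ent-≤ = ≲⇒≤ (Ent f) influenceBound (≲-trans
      (≤⇒≲ λ m → linear (0≤totalInf f) (solve 2 (λ I E → I :- con 0ℚ := E :+ I :- E) refl (totalInf f) (seq (Ent f) m)))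
      Ent-≲)

    Ent-< : NonConstant f → Ent f Defs.< influenceBound
    Ent-< nc = ≲⇒< (Ent f) influenceBound (nonConstant⇒0<totalInf f nc) Ent-≲

open import Defs

theorem1p3 : ∃₂ λ (c₁ c₂ : ℝ) → 0ℝ < c₁ × 0ℝ < c₂ ×
    ((n : ℕ) → 1 ℕ.≤ n → (f : BooleanFunction n) →
    let bound = c₁ * fromℚ (totalInf f) + c₂ * ∑ (allFin n) (λ k → plog1/p (Inf k f))
    in Ent f ≤ bound × (NonConstant f → Ent f < bound))
theorem1p3 = fromℚ 3ℚ , fromℚ 1ℚ , 0<fromℚ (positive⁻¹ 3ℚ) , 0<fromℚ (positive⁻¹ 1ℚ) , λ n _ f → Ent-≤ f , Ent-< f
  where
  open import Data.Rational.Base using (1ℚ)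
  open import Data.Rational.Properties using (positive⁻¹)
  open SpectralEntropy using (3ℚ; 0<fromℚ; Ent-≤; Ent-<)
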